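{- Let $G$ be a finite simple undirected graph on $n$ vertices and let $M$ be the multipartite graph on which the clean-factor series of $G$ terminates. Let $k$ and $c$ be integers such that every vertex of $G$ belongs to at most $k$ maximal cliques of $G$ and every maximal clique of $G$ contains at most $c$ vertices. Then $$|V(M)|\le \min\left(k\,2^c\,c!\,,\ 2^k\,k!+1\right)\times n.$$
   Context: All graphs are finite, undirected and simple. A $p$-partite graph $G=(V_0,\ldots,V_{p-1},E)$ is a graph together with an ordered partition $(V_0,\ldots,V_{p-1})$ of its vertex set into $p$ non-empty parts (levels) such that every edge joins vertices in different parts. $N(x)$ is the neighbourhood of $x$ and $N_i(x)=N(x)\cap V_i$. Factorisation. Given a $p$-partite graph $G=(V_0,\ldots,V_{p-1},E)$ with $p\ge 2$ and a set $V'_p$ of subsets of $V(G)$, the factorisation of $G$ with respect to $V'_p$ is the graph $G'=(V_0,\ldots,V_p,E\cup E_+)$, where the new level $V_p$ is the set of inclusion-maximal elements of $V'_p$ and $E_+=\{Xy \mid X\in V_p,\ y\in X\}$. It is called effective if $V_p\neq\emptyset$. The set $V^+_p$. For a $p$-partite graph, $V^+_p$ is the set of all sets $\{x_1,\ldots,x_l\}\cup\bigcap_{1\le i\le l}N(x_i)$ where $l\ge 2$, $x_1,\ldots,x_l$ are distinct elements of $V_{p-1}$, and $|\bigcap_{1\le i\le l}N(x_i)|\ge 2$. The set $V^*_p$. - If $p\ge 5$: $V^*_p$ is the set of $X\in V^+_p$ such that $|\bigcap_{x\in X\cap V_{p-1}}N_{p-2}(x)|\ge 2$, and $N_{p-3}(x)=N_{p-3}(y)$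 for all $x,y\in X\cap V_{p-1}$, and $|\bigcap_{x\in X\cap V_{p-1}}N_1(x)|\ge 2$. - If $p=4$: $V^*_4$ is the set of $X\in V^+_4$ such that $|\bigcap_{x\in X\cap V_3}N_2(x)|\ge 2$, $|\bigcap_{x\in X\cap V_3}N_1(x)|\ge 2$, and $N_0(x)=N_0(y)$ for all $x,y\in X\cap V_3$. - If $p=3$: $V^*_3$ is the set of $X\in V^+_3$ such that $|\bigcap_{x\in X\cap V_2}N_1(x)|\ge 2$ and $|\bigcap_{x\in X\cap V_2}N_0(x)|\ge 2$. - If $p=2$: $V^*_2=V^+_2$. The clean-factor graph of a $p$-partite graph is its factorisation with respect to $V^*_p$. Clean-factor series of a graph $G$. $\mathcal{K}(G)$ is the set of maximal cliques of $G$. $G_1=B(G)$ is the vertex-clique-incidence bipartite graph: level $V_0=V(G)$, level $V_1=\mathcal{K}(G)$, with an edge $vC$ whenever $v\in C$. For $i\ge 1$, $G_{i+1}$ is the clean-factor graph of $G_i$ if that factorisation is effective, and is undefined otherwise. The series is always finite; $M$ denotes its last defined graph, i.e. the $G_i$ whose clean-factor factorisation is not effective. -}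

module Defs where

open import Data.Empty using (⊥; ⊥-elim)
open import Data.Fin using (Fin; zero; suc; toℕ; fromℕ; fromℕ<; inject₁; splitAt; _↑ˡ_; _↑ʳ_)
open import Data.Fin.Properties
  using (fromℕ≢inject₁; inject₁-injective; splitAt-↑ˡ; splitAt-↑ʳ)
  renaming (_≟_ to _≟ᶠ_)
open import Data.Fin.Relation.Unary.Top using (view; ‵fromℕ; ‵inject₁)
open import Data.Fin.Subset as Subset
  using (Subset; inside; outside; _∈_; _⊆_; _⊂_; _∩_; _∪_; ∣_∣; Lift)
open import Data.Fin.Subset.Induction using (⊃-wellFounded; Acc; acc)
open import Data.Fin.Subset.Properties
  using (_∈?_; _⊆?_; _⊂?_; anySubset?; Lift?; ∉⊥)
open import Data.List.Base as List using (List; []; _∷_; length)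
open import Data.List.Membership.Propositional using () renaming (_∈_ to _∈ˡ_)
open import Data.List.Membership.Propositional.Properties
  using (∈-map⁺; ∈-++⁺ˡ; ∈-++⁺ʳ; ∈-filter⁺)
open import Data.List.Relation.Unary.Any using (here)
open import Data.Nat.Base using (ℕ; zero; suc; _+_; _≤_; NonZero; >-nonZero⁻¹)
open import Data.Nat.Properties using (_≤?_) renaming (_≟_ to _≟ⁿ_)
open import Data.Product.Base using (_×_; ∃; _,_)
open import Data.Sum.Base using (_⊎_; inj₁; inj₂; [_,_]′)
open import Data.Vec.Base as Vec using ([]; _∷_)
open import Data.Vec.Properties using (≡-dec)
open import Data.Bool.Properties using () renaming (_≟_ to _≟ᵇ_)
open import Function.Base using (_∘_; const)
open import Level using (0ℓ)
open import Relation.Binary.Core using (Rel)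
open import Relation.Binary.Definitions
  using (DecidableEquality; Symmetric; Irreflexive)
  renaming (Decidable to Decidable₂)
open import Relation.Binary.PropositionalEquality
  using (_≡_; _≢_; refl; sym; cong)
open import Relation.Nullary.Decidable
  using (yes; no; does; _×-dec_; _→-dec_; ¬?)
open import Relation.Nullary.Negation using (¬_)
open import Relation.Unary using (Pred; Decidable)

private
  variable
    n p q : ℕ

------------------------------------------------------------------------
-- Sets of vertices

infix 4 _≟ˢ_

_≟ˢ_ : DecidableEquality (Subset n)
_≟ˢ_ = ≡-dec _≟ᵇ_

⟪_⟫ : {P : Pred (Fin n) 0ℓ} → Decidable P → Subset n
⟪ P? ⟫ = Vec.tabulate (does ∘ P?)

⋂[_]_ : Subset n → (Fin n → Subset n) → Subset n
⋂[ S ] F = ⟪ (λ y → Lift? (λ x → y ∈? F x) S) ⟫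

subsets : ∀ n → List (Subset n)
subsets zero    = [] ∷ []
subsets (suc n) =
  List.map (outside ∷_) (subsets n) List.++ List.map (inside ∷_) (subsets n)

∈-subsets : (S : Subset n) → S ∈ˡ subsets n
∈-subsets []            = here refl
∈-subsets (outside ∷ S) = ∈-++⁺ˡ (∈-map⁺ (outside ∷_) (∈-subsets S))
∈-subsets (inside  ∷ S) =
  ∈-++⁺ʳ (List.map (outside ∷_) (subsets _)) (∈-map⁺ (inside ∷_) (∈-subsets S))

Maximal : Pred (Subset n) 0ℓ → Pred (Subset n) 0ℓ
Maximal P X = P X × ¬ (∃ λ Y → P Y × X ⊂ Y)

maximal? : {P : Pred (Subset n) 0ℓ} → Decidable P → Decidable (Maximal P)
maximal? P? X = P? X ×-dec ¬? (anySubset? (λ Y → P? Y ×-dec (X ⊂? Y)))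

maximals : {P : Pred (Subset n) 0ℓ} → Decidable P → List (Subset n)
maximals P? = List.filter (maximal? P?) (subsets _)

∃⇒∃-maximal : {P : Pred (Subset n) 0ℓ} → Decidable P → ∃ P → ∃ (Maximal P)
∃⇒∃-maximal {P = P} P? (X , px) = go X px (⊃-wellFounded X)
  where
  go : ∀ X → P X → Acc Subset._⊃_ X → ∃ (Maximal P)
  go X px (acc rs) with anySubset? (λ Y → P? Y ×-dec (X ⊂? Y))
  ... | yes (Y , py , X⊂Y) = go Y py (rs X⊂Y)
  ... | no  none           = X , px , none

∃⇒maximals≢[] : {P : Pred (Subset n) 0ℓ} (P? : Decidable P) →
                ∃ P → maximals P? ≢ []
∃⇒maximals≢[] P? ∃P eq with ∃⇒∃-maximal P? ∃P
... | X , max with maximals P? | ∈-filter⁺ (maximal? P?) (∈-subsets X) max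
∃⇒maximals≢[] P? ∃P refl | X , max | [] | ()

------------------------------------------------------------------------
-- Graphs and maximal cliques

record Graph (n : ℕ) : Set₁ where
  field
    Adj    : Rel (Fin n) 0ℓ
    Adj?   : Decidable₂ Adj
    symm   : Symmetric Adj
    irrefl : Irreflexive _≡_ Adj

  N : Fin n → Subset n
  N x = ⟪ Adj? x ⟫

Clique : Graph n → Pred (Subset n) 0ℓ
Clique G S = Lift (λ x → Lift (λ y → x ≢ y → Graph.Adj G x y) S) S

clique? : (G : Graph n) → Decidable (Clique G)
clique? G S =
  Lift? (λ x → Lift? (λ y → ¬? (x ≟ᶠ y) →-dec Graph.Adj? G x y) S) S

MaximalClique : Graph n → Pred (Subset n) 0ℓ
MaximalClique G = Maximal (Clique G)

maximalCliques : Graph n → List (Subset n)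
maximalCliques G = maximals (clique? G)

------------------------------------------------------------------------
-- Multipartite graphs

record Multipartite (p : ℕ) : Set₁ where
  field
    order    : ℕ
    graph    : Graph order
    level    : Fin order → Fin p
    nonempty : ∀ i → ∃ λ x → level x ≡ i
    proper   : ∀ {x y} → Graph.Adj graph x y → level x ≢ level y

  open Graph graph public

  -- Levels are numbered by naturals here so that V (p - 1), N_(p - 3), …
  -- can be written without casts; V i is empty for i ≥ p.
  V : ℕ → Subset order
  V i = ⟪ (λ x → toℕ (level x) ≟ⁿ i) ⟫

  N[_] : ℕ → Fin order → Subset order
  N[ i ] x = N x ∩ V i

open Multipartite using (order)

-- Adds a new top level with one vertex for each set in Xs, joined to exactly
-- the elements of that set.  In Fin (order + length Xs) the first `order`
-- vertices are the old ones.
module AddLevel (G : Multipartite p) (Xs : List (Subset (order G))) where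
  private
    module G = Multipartite G
    m = length Xs

  Vertex : Set
  Vertex = Fin G.order ⊎ Fin m

  split : Fin (G.order + m) → Vertex
  split = splitAt G.order

  E : Rel Vertex 0ℓ
  E (inj₁ x) (inj₁ y) = G.Adj x y
  E (inj₁ y) (inj₂ j) = y ∈ List.lookup Xs j
  E (inj₂ j) (inj₁ y) = y ∈ List.lookup Xs j
  E (inj₂ _) (inj₂ _) = ⊥

  E? : Decidable₂ E
  E? (inj₁ x) (inj₁ y) = G.Adj? x y
  E? (inj₁ y) (inj₂ j) = y ∈? List.lookup Xs j
  E? (inj₂ j) (inj₁ y) = y ∈? List.lookup Xs j
  E? (inj₂ _) (inj₂ _) = no λ ()

  E-sym : Symmetric E
  E-sym {inj₁ x} {inj₁ y} e = G.symm e
  E-sym {inj₁ y} {inj₂ j} e = e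
  E-sym {inj₂ j} {inj₁ y} e = e

  E-irrefl : ∀ v → ¬ E v v
  E-irrefl (inj₁ x) = G.irrefl refl

  lev : Vertex → Fin (suc p)
  lev = [ inject₁ ∘ G.level , const (fromℕ p) ]′

  E-proper : ∀ v w → E v w → lev v ≢ lev w
  E-proper (inj₁ x) (inj₁ y) e eq = G.proper e (inject₁-injective eq)
  E-proper (inj₁ y) (inj₂ j) e eq = fromℕ≢inject₁ (sym eq)
  E-proper (inj₂ j) (inj₁ y) e eq = fromℕ≢inject₁ eq

  lev-nonempty : Fin m → ∀ i → ∃ λ v → lev (split v) ≡ i
  lev-nonempty j i with view i
  ... | ‵fromℕ     = G.order ↑ʳ j , cong lev (splitAt-↑ʳ G.order m j)
  ... | ‵inject₁ k with G.nonempty k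
  ...   | x , refl = x ↑ˡ m , cong lev (splitAt-↑ˡ G.order x m)

  some : (Ys : List (Subset G.order)) → Ys ≢ [] → Fin (length Ys)
  some []      ne = ⊥-elim (ne refl)
  some (_ ∷ _) ne = zero

  addLevel : Xs ≢ [] → Multipartite (suc p)
  addLevel ne = record
    { order    = G.order + m
    ; graph    = record
      { Adj    = λ v w → E (split v) (split w)
      ; Adj?   = λ v w → E? (split v) (split w)
      ; symm   = λ {v} {w} → E-sym {split v} {split w}
      ; irrefl = λ { {v} refl → E-irrefl (split v) }
      }
    ; level    = lev ∘ split
    ; nonempty = lev-nonempty (some Xs ne)
    ; proper   = λ {v} {w} → E-proper (split v) (split w)
    }

open AddLevel using (addLevel)

-- The factorisation with respect to the set {X ∣ P X}.  A level of a
-- multipartite graph is non-empty, so only the effective one is defined.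
EffectiveFactorisation : (G : Multipartite p) {P : Pred (Subset (order G)) 0ℓ} →
                         Decidable P → Set
EffectiveFactorisation G P? = maximals P? ≢ []

factorisation : (G : Multipartite p) {P : Pred (Subset (order G)) 0ℓ}
                (P? : Decidable P) → EffectiveFactorisation G P? →
                Multipartite (suc p)
factorisation G P? = addLevel G (maximals P?)

------------------------------------------------------------------------
-- The sets V⁺ and V*

module _ (G : Multipartite (suc p)) where
  open Multipartite G hiding (order)

  V⁺ : Pred (Subset (order G)) 0ℓ
  V⁺ X = ∃ λ S → S ⊆ V p × 2 ≤ ∣ S ∣ × 2 ≤ ∣ ⋂[ S ] N ∣ × X ≡ S ∪ (⋂[ S ] N)

  V⁺? : Decidable V⁺
  V⁺? X = anySubset? λ S →
    (S ⊆? V p) ×-dec (2 ≤? ∣ S ∣) ×-dec (2 ≤? ∣ ⋂[ S ] N ∣) ×-dec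
    (X ≟ˢ S ∪ (⋂[ S ] N))

  CommonN≥2 : ℕ → Pred (Subset (order G)) 0ℓ
  CommonN≥2 i X = 2 ≤ ∣ ⋂[ X ∩ V p ] N[ i ] ∣

  commonN≥2? : ∀ i → Decidable (CommonN≥2 i)
  commonN≥2? i X = 2 ≤? ∣ ⋂[ X ∩ V p ] N[ i ] ∣

  EqualN : ℕ → Pred (Subset (order G)) 0ℓ
  EqualN i X = Lift (λ x → Lift (λ y → N[ i ] x ≡ N[ i ] y) (X ∩ V p)) (X ∩ V p)

  equalN? : ∀ i → Decidable (EqualN i)
  equalN? i X =
    Lift? (λ x → Lift? (λ y → N[ i ] x ≟ˢ N[ i ] y) (X ∩ V p)) (X ∩ V p)

-- The graph has 2 + q levels: the clauses are for 2, 3, 4 and 5 + r levels.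
V* : (G : Multipartite (2 + q)) → Pred (Subset (order G)) 0ℓ
V* {0} G X = V⁺ G X
V* {1} G X = V⁺ G X × CommonN≥2 G 1 X × CommonN≥2 G 0 X
V* {2} G X = V⁺ G X × CommonN≥2 G 2 X × CommonN≥2 G 1 X × EqualN G 0 X
V* {suc (suc (suc r))} G X =
  V⁺ G X × CommonN≥2 G (3 + r) X × EqualN G (2 + r) X × CommonN≥2 G 1 X

V*? : (G : Multipartite (2 + q)) → Decidable (V* G)
V*? {0} G X = V⁺? G X
V*? {1} G X = V⁺? G X ×-dec commonN≥2? G 1 X ×-dec commonN≥2? G 0 X
V*? {2} G X =
  V⁺? G X ×-dec commonN≥2? G 2 X ×-dec commonN≥2? G 1 X ×-dec equalN? G 0 X
V*? {suc (suc (suc r))} G X =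
  V⁺? G X ×-dec commonN≥2? G (3 + r) X ×-dec equalN? G (2 + r) X ×-dec
  commonN≥2? G 1 X

------------------------------------------------------------------------
-- The clean-factor series

Effective : Multipartite (2 + q) → Set
Effective G = EffectiveFactorisation G (V*? G)

cleanFactor : (G : Multipartite (2 + q)) → Effective G → Multipartite (3 + q)
cleanFactor G = factorisation G (V*? G)

edgeless : ∀ n → .{{NonZero n}} → Multipartite 1
edgeless n = record
  { order    = n
  ; graph    = record
    { Adj    = λ _ _ → ⊥
    ; Adj?   = λ _ _ → no λ ()
    ; symm   = λ ()
    ; irrefl = λ _ ()
    }
  ; level    = λ _ → zero
  ; nonempty = λ { zero → fromℕ< (>-nonZero⁻¹ n) , refl }
  ; proper   = λ ()
  }

-- The vertex-clique-incidence graph.  Its levels have to be non-empty, hence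
-- the restriction to graphs with at least one vertex.
B : .{{NonZero n}} → Graph n → Multipartite 2
B {n} G = addLevel (edgeless n) (maximalCliques G)
  (∃⇒maximals≢[] (clique? G) (Subset.⊥ , λ x∈⊥ → ⊥-elim (∉⊥ x∈⊥)))

data CleanFactorSeries .{{_ : NonZero n}} (G : Graph n) :
       ∀ {q} → Multipartite (2 + q) → Set₁ where
  first : CleanFactorSeries G (B G)
  next  : {H : Multipartite (2 + q)} → CleanFactorSeries G H →
          (e : Effective H) → CleanFactorSeries G (cleanFactor H e)

TerminatesAt : .{{_ : NonZero n}} → Graph n → Multipartite (2 + q) → Set₁
TerminatesAt G M = CleanFactorSeries G M × ¬ Effective M

{-# OPTIONS --safe #-}
module Submission where

-- From level 2 on, a vertex X of the series is coded by a strictly ascending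
-- chain of sets of maximal cliques.  The code of a vertex of level 2 consists of
-- its neighbourhood on level 1.  A vertex X of level p ≥ 3 contains a vertex y of
-- level p - 1 that agrees with X on the levels up to p - 2, level 1 excepted: it
-- is the maximal set generated by the common neighbours on level p - 2 of the
-- elements of X on level p - 1 (for p = 3, by all cliques that contain X ∩ V₀).
-- The code of X is the code of y preceded by the neighbourhood of X on level 1.
-- Maximality makes the code injective and its sets closed: they contain every
-- maximal clique that includes the intersection of their elements.
--
-- All cliques in a chain contain a common vertex v, so a chain consists of
-- subsets of a set of at most k cliques, and a set of size k has at most 2^k k!
-- strict chains of non-empty subsets.  Alternatively, fix one of the at most k
-- cliques D through v that belong to all sets of the chain; the intersections
-- of these sets form a chain of subsets of D.

open import Defs
open import Data.Bool.Base using (true; false)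
open import Data.Fin using (Fin; zero; suc; toℕ; fromℕ<; _↑ˡ_; _↑ʳ_; splitAt)
import Data.Fin.Properties as Fin
open import Data.Fin.Subset
  using (Subset; inside; outside; _∈_; _∉_; _⊆_; _⊂_; _∩_; _∪_; ∣_∣; ⁅_⁆; Nonempty)
import Data.Fin.Subset as Subset
open import Data.Fin.Subset.Properties
open import Data.List using (List; []; _∷_; length; filter; map; concatMap; allFin)
import Data.List as List
open import Data.List.Membership.Propositional using (find; lose) renaming (_∈_ to _∈ˡ_)
open import Data.List.Membership.Propositional.Properties
  using (∈-lookup; ∈-filter⁺; ∈-filter⁻; ∈-map⁺; ∈-map⁻; ∈-concatMap⁺; ∈-concatMap⁻; ∈-allFin)
open import Data.List.Properties
  using (length-map; length-++; length-tabulate; ∷-injectiveˡ; ∷-injectiveʳ)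
open import Data.List.Relation.Unary.All as All using (All; []; _∷_)
open import Data.List.Relation.Unary.AllPairs using ([]; _∷_)
open import Data.List.Relation.Unary.Any as Any using (here; there)
open import Data.List.Relation.Unary.Any.Properties using (lookup-index)
open import Data.List.Relation.Unary.Linked using (Linked; [-]; _∷_)
open import Data.List.Relation.Unary.Unique.Propositional using (Unique)
import Data.List.Relation.Unary.Unique.Propositional.Properties as Unique
open import Data.Nat
  using (ℕ; zero; suc; _+_; _*_; _^_; _!; _≤_; _<_; _⊓_; NonZero; z≤n; s≤s; s≤s⁻¹; >-nonZero⁻¹)
import Data.Nat.Properties as ℕ
open import Data.Nat.Tactic.RingSolver using (solve-∀)
open import Data.Product using (_×_; ∃; ∃₂; _,_; proj₁; proj₂)
open import Data.Sum using (_⊎_; inj₁; inj₂)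
open import Data.Vec using ([]; _∷_)
import Data.Vec as Vec
open import Data.Vec.Properties using (lookup∘tabulate; lookup⇒[]=; []=⇒lookup)
open import Function using (_∘_; Injective; id)
open import Level using (0ℓ)
open import Relation.Binary.PropositionalEquality
open import Relation.Nullary using (¬_; Dec; yes; no; does; contradiction)
open import Relation.Nullary.Decidable using (dec-true; decidable-stable; _×-dec_; _⊎-dec_; ¬?)
open import Relation.Unary using (Pred; Decidable)

private
  variable
    m n q : ℕ
    A A′ : Set

-- Finite subsets, maximal sets and lists

module _ {P : Pred (Fin n) 0ℓ} (P? : Decidable P) where

  ∈⟪⟫⁺ : ∀ {x} → P x → x ∈ ⟪ P? ⟫
  ∈⟪⟫⁺ {x} px = lookup⇒[]= x _
    (trans (lookup∘tabulate (does ∘ P?) x) (dec-true (P? x) px))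

  ∈⟪⟫⁻ : ∀ {x} → x ∈ ⟪ P? ⟫ → P x
  ∈⟪⟫⁻ {x} x∈ with P? x | trans (sym (lookup∘tabulate (does ∘ P?) x)) ([]=⇒lookup x∈)
  ... | yes px | _ = px
  ... | no  _  | ()

module _ {S : Subset n} {F : Fin n → Subset n} where

  ∈⋂⁺ : ∀ {y} → (∀ {x} → x ∈ S → y ∈ F x) → y ∈ ⋂[ S ] F
  ∈⋂⁺ h = ∈⟪⟫⁺ (λ y → Lift? (λ x → y ∈? F x) S) h

  ∈⋂⁻ : ∀ {x y} → y ∈ ⋂[ S ] F → x ∈ S → y ∈ F x
  ∈⋂⁻ y∈ = ∈⟪⟫⁻ (λ y → Lift? (λ x → y ∈? F x) S) y∈

⋂-antitone : {S T : Subset n} {F : Fin n → Subset n} → S ⊆ T → ⋂[ T ] F ⊆ ⋂[ S ] F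
⋂-antitone {F = F} S⊆T y∈ = ∈⋂⁺ {F = F} λ x∈ → ∈⋂⁻ {F = F} y∈ (S⊆T x∈)

⊆∧⊈⇒⊂ : {S T : Subset n} → S ⊆ T → ¬ T ⊆ S → S ⊂ T
⊆∧⊈⇒⊂ {S = S} {T} S⊆T T⊈S with Fin.any? (λ x → (x ∈? T) ×-dec ¬? (x ∈? S))
... | yes (x , x∈T , x∉S) = S⊆T , x , x∈T , x∉S
... | no  none = contradiction
  (λ {x} x∈T → decidable-stable (x ∈? S) λ x∉S → none (x , x∈T , x∉S)) T⊈S

1≤∣S∣⇒Nonempty : {S : Subset n} → 1 ≤ ∣ S ∣ → Nonempty S
1≤∣S∣⇒Nonempty {n = n} {S = S} 1≤ with nonempty? S
... | yes ne    = ne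
... | no  empty = contradiction 1≤ (subst (λ k → ¬ 1 ≤ k)
  (sym (trans (cong ∣_∣ (Empty-unique empty)) (∣⊥∣≡0 n))) λ ())

another : {S : Subset n} → 2 ≤ ∣ S ∣ → ∀ x → ∃ λ y → y ∈ S × y ≢ x
another {S = S} 2≤ x with Fin.any? (λ y → (y ∈? S) ×-dec ¬? (y Fin.≟ x))
... | yes found = found
... | no  none  = contradiction (ℕ.≤-trans 2≤ (p⊆q⇒∣p∣≤∣q∣ S⊆⁅x⁆))
  (subst (λ k → ¬ 2 ≤ k) (sym (∣⁅x⁆∣≡1 x)) λ { (s≤s ()) })
  where
  S⊆⁅x⁆ : S ⊆ ⁅ x ⁆
  S⊆⁅x⁆ {y} y∈S = decidable-stable (y ∈? ⁅ x ⁆) λ y∉ →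
    none (y , y∈S , λ { refl → y∉ (x∈⁅x⁆ x) })

2≤∣S∣⇒distinct : {S : Subset n} → 2 ≤ ∣ S ∣ → ∃₂ λ x y → x ∈ S × y ∈ S × y ≢ x
2≤∣S∣⇒distinct 2≤ with 1≤∣S∣⇒Nonempty (ℕ.≤-trans (s≤s z≤n) 2≤)
... | x , x∈S with another 2≤ x
... | y , y∈S , y≢x = x , y , x∈S , y∈S , y≢x

distinct⇒2≤∣S∣ : {S : Subset n} {x y : Fin n} → x ∈ S → y ∈ S → y ≢ x → 2 ≤ ∣ S ∣
distinct⇒2≤∣S∣ {S = S} {x} {y} x∈S y∈S y≢x =
  subst (λ k → suc k ≤ ∣ S ∣) (∣⁅x⁆∣≡1 x) (p⊂q⇒∣p∣<∣q∣
    ( (λ z∈ → subst (_∈ S) (sym (x∈⁅y⁆⇒x≡y x z∈)) x∈S)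
    , y , y∈S , λ y∈ → y≢x (x∈⁅y⁆⇒x≡y x y∈)))

image-2≤ : {S : Subset m} {T : Subset n} (f : Fin m → Fin n) →
           (∀ {y} → y ∈ T → ∃ λ x → x ∈ S × f x ≡ y) → 2 ≤ ∣ T ∣ → 2 ≤ ∣ S ∣
image-2≤ f onto 2≤ with 2≤∣S∣⇒distinct 2≤
... | y , y′ , y∈ , y′∈ , y′≢y with onto y∈ | onto y′∈
... | x , x∈ , refl | x′ , x′∈ , refl = distinct⇒2≤∣S∣ x∈ x′∈ (y′≢y ∘ cong f)

lookup-injective : {xs : List A} → Unique xs → Injective _≡_ _≡_ (List.lookup xs)
lookup-injective (_ ∷ _)   {zero}  {zero}  _  = refl
lookup-injective (x∉ ∷ _)  {zero}  {suc j} eq = contradiction eq (All.lookup x∉ (∈-lookup j))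
lookup-injective (x∉ ∷ _)  {suc i} {zero}  eq = contradiction (sym eq) (All.lookup x∉ (∈-lookup i))
lookup-injective (_ ∷ xs!) {suc i} {suc j} eq = cong suc (lookup-injective xs! eq)

subsets-unique : ∀ n → Unique (subsets n)
subsets-unique zero    = [] ∷ []
subsets-unique (suc n) = Unique.++⁺
  (Unique.map⁺ (cong Vec.tail) (subsets-unique n))
  (Unique.map⁺ (cong Vec.tail) (subsets-unique n))
  λ (S∈out , S∈in) → disjoint S∈out S∈in
  where
  disjoint : ∀ {S} → S ∈ˡ map (outside ∷_) (subsets n) → ¬ S ∈ˡ map (inside ∷_) (subsets n)
  disjoint S∈out S∈in with ∈-map⁻ _ S∈out | ∈-map⁻ _ S∈in
  ... | _ , _ , refl | _ , _ , ()

module _ {P : Pred (Subset n) 0ℓ} (P? : Decidable P) where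

  lookup-maximal : ∀ i → Maximal P (List.lookup (maximals P?) i)
  lookup-maximal i = proj₂ (∈-filter⁻ (maximal? P?) {xs = subsets n} (∈-lookup i))

  maximal-index : ∀ {X} → Maximal P X → ∃ λ i → List.lookup (maximals P?) i ≡ X
  maximal-index {X} max with ∈-filter⁺ (maximal? P?) (∈-subsets X) max
  ... | X∈ = Any.index X∈ , sym (lookup-index X∈)

  maximals-unique : Unique (maximals P?)
  maximals-unique = Unique.filter⁺ (maximal? P?) (subsets-unique n)

  ∃-maximal-above : ∀ {X} → P X → ∃ λ Y → Maximal P Y × X ⊆ Y
  ∃-maximal-above {X} px
    with ∃⇒∃-maximal (λ Y → P? Y ×-dec (X ⊆? Y)) (X , px , λ x∈ → x∈)
  ... | Y , (py , X⊆Y) , none =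
    Y , (py , λ (Z , pz , Y⊂Z) → none (Z , (pz , ⊆-trans X⊆Y (proj₁ Y⊂Z)) , Y⊂Z)) , X⊆Y

  maximal-⊆ : ∀ {X Y} → Maximal P X → P Y → X ⊆ Y → Y ⊆ X
  maximal-⊆ {X} {Y} (_ , none) py X⊆Y {x} x∈Y = decidable-stable (x ∈? X) λ x∉X →
    none (Y , py , X⊆Y , x , x∈Y , x∉X)

length-concatMap-≤ : (f : A → List A′) (b : ℕ) (xs : List A) →
                     (∀ {x} → x ∈ˡ xs → length (f x) ≤ b) →
                     length (concatMap f xs) ≤ length xs * b
length-concatMap-≤ f b []       _  = z≤n
length-concatMap-≤ f b (x ∷ xs) h  = subst (_≤ b + length xs * b) (sym (length-++ (f x)))
  (ℕ.+-mono-≤ (h (here refl)) (length-concatMap-≤ f b xs (h ∘ there)))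

injective⇒≤length : (f : Fin m → A) → Injective _≡_ _≡_ f → (xs : List A) →
                    (∀ i → f i ∈ˡ xs) → m ≤ length xs
injective⇒≤length f f-inj xs f∈ = Fin.injective⇒≤ λ {i} {j} eq → f-inj
  (trans (lookup-index (f∈ i)) (trans (cong (List.lookup xs) eq) (sym (lookup-index (f∈ j)))))

-- Links the hypothesis on k, which counts entries in the list of maximal cliques, with the size of
-- the index set `through v`.
∣⟪lookup⟫∣ : {P : Pred A 0ℓ} (P? : Decidable P) (xs : List A) →
             ∣ ⟪ P? ∘ List.lookup xs ⟫ ∣ ≡ length (filter P? xs)
∣⟪lookup⟫∣ P? []       = refl
∣⟪lookup⟫∣ P? (x ∷ xs) with does (P? x)
... | true  = cong suc (∣⟪lookup⟫∣ P? xs)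
... | false = ∣⟪lookup⟫∣ P? xs

-- Chains of subsets

-- For a strict chain As above P: the strict chains above outside ∷ P that give
-- As when the element zero is removed from their members, and then the value P
-- and repetitions are dropped.
insert : Subset n → List (Subset n) → List (List (Subset (suc n)))
insert P []       = [] ∷ ((inside ∷ P) ∷ []) ∷ []
insert P (A ∷ As) =
  ((inside ∷ P) ∷ map (inside ∷_) (A ∷ As)) ∷ map (inside ∷_) (A ∷ As) ∷
  map ((outside ∷ A) ∷_) (insert A As)

-- Lists the strict chains of non-empty subsets of S, the empty chain included, by adding the
-- elements of S one at a time. Inserting above `Subset.⊥` keeps the members non-empty.
chains : Subset n → List (List (Subset n))
chains []            = [] ∷ []
chains (outside ∷ S) = map (map (outside ∷_)) (chains S)
chains (inside  ∷ S) = concatMap (insert Subset.⊥) (chains S)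

-- Before each set of the chain there are two choices: zero enters in a new set or together with
-- that set. After the last set it enters in a new set or never.
length-insert : (P : Subset n) (As : List (Subset n)) →
                length (insert P As) ≡ 2 * suc (length As)
length-insert P []       = refl
length-insert P (A ∷ As) = begin
  2 + length (map ((outside ∷ A) ∷_) (insert A As)) ≡⟨ cong (2 +_) (length-map _ (insert A As)) ⟩
  2 + length (insert A As)                          ≡⟨ cong (2 +_) (length-insert A As) ⟩
  2 + 2 * suc (length As)                           ≡⟨ ℕ.*-suc 2 (suc (length As)) ⟨
  2 * suc (suc (length As))                         ∎
  where open ≡-Reasoning

∈-insert⇒length-≤ : (P : Subset n) (As : List (Subset n)) {Bs : List (Subset (suc n))} →
                    Bs ∈ˡ insert P As → length Bs ≤ suc (length As)
∈-insert⇒length-≤ P []       (here refl)         = z≤n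
∈-insert⇒length-≤ P []       (there (here refl)) = ℕ.≤-refl
∈-insert⇒length-≤ P (A ∷ As) (here refl)         =
  ℕ.≤-reflexive (cong (2 +_) (length-map _ As))
∈-insert⇒length-≤ P (A ∷ As) (there (here refl)) =
  ℕ.≤-trans (ℕ.≤-reflexive (cong suc (length-map _ As))) (ℕ.n≤1+n _)
∈-insert⇒length-≤ P (A ∷ As) (there (there Bs∈)) with ∈-map⁻ _ Bs∈
... | _ , Bs∈′ , refl = s≤s (∈-insert⇒length-≤ A As Bs∈′)

-- Each inserted element lengthens a chain by at most one set.
∈-chains⇒length-≤ : (S : Subset n) {As : List (Subset n)} → As ∈ˡ chains S → length As ≤ ∣ S ∣
∈-chains⇒length-≤ []            (here refl) = z≤n
∈-chains⇒length-≤ (outside ∷ S) As∈ with ∈-map⁻ _ As∈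
... | Bs , Bs∈ , refl =
  subst (_≤ ∣ S ∣) (sym (length-map _ Bs)) (∈-chains⇒length-≤ S Bs∈)
∈-chains⇒length-≤ (inside  ∷ S) As∈ with find (∈-concatMap⁻ (insert Subset.⊥) {xs = chains S} As∈)
... | Bs , Bs∈ , As∈′ =
  ℕ.≤-trans (∈-insert⇒length-≤ _ Bs As∈′) (s≤s (∈-chains⇒length-≤ S Bs∈))

-- A chain in a set of size s has at most s members, so a further element multiplies the number of
-- chains by at most 2 (s + 1).
length-chains : (S : Subset n) → length (chains S) ≤ 2 ^ ∣ S ∣ * ∣ S ∣ !
length-chains []            = ℕ.≤-refl
length-chains (outside ∷ S) =
  subst (_≤ 2 ^ ∣ S ∣ * ∣ S ∣ !) (sym (length-map _ (chains S))) (length-chains S)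
length-chains (inside  ∷ S) = begin
  length (concatMap (insert Subset.⊥) (chains S))
    ≤⟨ length-concatMap-≤ _ (2 * suc ∣ S ∣) (chains S) bound ⟩
  length (chains S) * (2 * suc ∣ S ∣)
    ≤⟨ ℕ.*-monoˡ-≤ (2 * suc ∣ S ∣) (length-chains S) ⟩
  2 ^ ∣ S ∣ * ∣ S ∣ ! * (2 * suc ∣ S ∣)
    ≡⟨ rearrange (2 ^ ∣ S ∣) (∣ S ∣ !) (suc ∣ S ∣) ⟩
  2 ^ suc ∣ S ∣ * suc ∣ S ∣ ! ∎
  where
  open ℕ.≤-Reasoning

  bound : ∀ {As} → As ∈ˡ chains S → length (insert Subset.⊥ As) ≤ 2 * suc ∣ S ∣
  bound {As} As∈ = ℕ.≤-trans (ℕ.≤-reflexive (length-insert Subset.⊥ As))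
    (ℕ.*-monoʳ-≤ 2 (s≤s (∈-chains⇒length-≤ S As∈)))

  rearrange : ∀ a b c → a * b * (2 * c) ≡ 2 * a * (c * b)
  rearrange = solve-∀

-- Once zero has entered, all later sets contain it, so its removal keeps the chain strict.
uninside : {P : Subset n} {As : List (Subset (suc n))} {S : Subset n} →
           Linked _⊂_ ((inside ∷ P) ∷ As) → All (_⊆ inside ∷ S) As →
           ∃ λ Bs → As ≡ map (inside ∷_) Bs × Linked _⊂_ (P ∷ Bs) × All (_⊆ S) Bs
uninside {As = []}                   _            _              = [] , refl , [-] , []
uninside {As = (outside ∷ A) ∷ As} (P⊂A ∷ _)    _              =
  contradiction (proj₁ P⊂A Vec.here) λ ()
uninside {As = (inside  ∷ A) ∷ As} (P⊂A ∷ link) (A⊆S ∷ As⊆S) with uninside link As⊆S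
... | Bs , refl , link′ , Bs⊆S = A ∷ Bs , refl , drop-∷-⊂ P⊂A ∷ link′ , drop-∷-⊆ A⊆S ∷ Bs⊆S

unoutside : {P : Subset n} {As : List (Subset (suc n))} {S : Subset n} →
            Linked _⊂_ ((outside ∷ P) ∷ As) → All (_⊆ outside ∷ S) As →
            ∃ λ Bs → As ≡ map (outside ∷_) Bs × Linked _⊂_ (P ∷ Bs) × All (_⊆ S) Bs
unoutside {As = []}                   _            _              = [] , refl , [-] , []
unoutside {As = (inside  ∷ A) ∷ As} (_ ∷ _)      (A⊆S ∷ _)      =
  contradiction (A⊆S Vec.here) λ ()
unoutside {As = (outside ∷ A) ∷ As} (P⊂A ∷ link) (A⊆S ∷ As⊆S) with unoutside link As⊆S
... | Bs , refl , link′ , Bs⊆S = A ∷ Bs , refl , drop-∷-⊂ P⊂A ∷ link′ , drop-∷-⊆ A⊆S ∷ Bs⊆S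

-- Follows the chain up to the first set that contains zero; from there on `uninside` applies.
uninsert : {P : Subset n} {As : List (Subset (suc n))} {S : Subset n} →
           Linked _⊂_ ((outside ∷ P) ∷ As) → All (_⊆ inside ∷ S) As →
           ∃ λ Bs → As ∈ˡ insert P Bs × Linked _⊂_ (P ∷ Bs) × All (_⊆ S) Bs
uninsert {As = []}                   _            _              = [] , here refl , [-] , []
uninsert {As = (outside ∷ A) ∷ As} (P⊂A ∷ link) (A⊆S ∷ As⊆S) with uninsert link As⊆S
... | Bs , As∈ , link′ , Bs⊆S =
  A ∷ Bs , there (there (∈-map⁺ _ As∈)) , drop-∷-⊂ P⊂A ∷ link′ , drop-∷-⊆ A⊆S ∷ Bs⊆S
-- Zero enters here. If A equals P, it enters in a set of its own, and A is the repetition to be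
-- dropped; otherwise it enters together with A.
uninsert {P = P} {As = (inside ∷ A) ∷ As} (P⊂A ∷ link) (A⊆S ∷ As⊆S)
  with uninside link As⊆S | A ⊆? P
... | []     , refl , link′ , Bs⊆S | yes A⊆P with ⊆-antisym A⊆P (drop-∷-⊆ (proj₁ P⊂A))
...   | refl = [] , there (here refl) , link′ , Bs⊆S
uninsert {P = P} {As = (inside ∷ A) ∷ As} (P⊂A ∷ link) (A⊆S ∷ As⊆S)
    | B ∷ Bs , refl , link′ , Bs⊆S | yes A⊆P with ⊆-antisym A⊆P (drop-∷-⊆ (proj₁ P⊂A))
...   | refl = B ∷ Bs , here refl , link′ , Bs⊆S
uninsert {P = P} {As = (inside ∷ A) ∷ As} (P⊂A ∷ link) (A⊆S ∷ As⊆S)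
    | Bs , refl , link′ , Bs⊆S | no A⊈P =
  A ∷ Bs , there (here refl) , ⊆∧⊈⇒⊂ (drop-∷-⊆ (proj₁ P⊂A)) A⊈P ∷ link′ , drop-∷-⊆ A⊆S ∷ Bs⊆S

∈-chains : (S : Subset n) {As : List (Subset n)} →
           Linked _⊂_ (Subset.⊥ ∷ As) → All (_⊆ S) As → As ∈ˡ chains S
∈-chains []            {[]}     _                          _    = here refl
∈-chains []            {A ∷ As} ((_ , () , _) ∷ _)         _
∈-chains (outside ∷ S) link As⊆S with unoutside link As⊆S
... | Bs , refl , link′ , Bs⊆S = ∈-map⁺ _ (∈-chains S link′ Bs⊆S)
∈-chains (inside  ∷ S) link As⊆S with uninsert link As⊆S
... | Bs , As∈ , link′ , Bs⊆S = ∈-concatMap⁺ (insert Subset.⊥) (lose (∈-chains S link′ Bs⊆S) As∈)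

-- Sets and least vertices

-- For 2 + q levels, q ≥ 1, the clauses CommonN≥2 of V* are at the levels q and
-- commonLevel q, and the clause EqualN, present for q ≥ 2, is at equalLevel q.
commonLevel : ℕ → ℕ
commonLevel 0             = 1
commonLevel 1             = 0
commonLevel (suc (suc _)) = 1

equalLevel : ℕ → ℕ
equalLevel 0                   = 0
equalLevel 1                   = 0
equalLevel 2                   = 0
equalLevel (suc (suc (suc r))) = 2 + r

-- Least vertices control every lower level except level 1, so the clause `EqualN` must not concern
-- that level.
equalLevel≢1 : ∀ q → equalLevel q ≢ 1
equalLevel≢1 0                   ()
equalLevel≢1 1                   ()
equalLevel≢1 2                   ()
equalLevel≢1 (suc (suc (suc r))) ()

equalLevel< : 1 ≤ q → equalLevel (suc q) < suc q
equalLevel< {suc zero}    _ = s≤s z≤n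
equalLevel< {suc (suc r)} _ = ℕ.≤-refl

module Membership {p} (H : Multipartite p) where
  open Multipartite H

  ∈V⁺ : ∀ {i x} → toℕ (level x) ≡ i → x ∈ V i
  ∈V⁺ {i} = ∈⟪⟫⁺ (λ x → toℕ (level x) ℕ.≟ i)

  ∈V⁻ : ∀ {i x} → x ∈ V i → toℕ (level x) ≡ i
  ∈V⁻ {i} = ∈⟪⟫⁻ (λ x → toℕ (level x) ℕ.≟ i)

  ∈N⁺ : ∀ {x y} → Adj x y → y ∈ N x
  ∈N⁺ {x} = ∈⟪⟫⁺ (Adj? x)

  ∈N⁻ : ∀ {x y} → y ∈ N x → Adj x y
  ∈N⁻ {x} = ∈⟪⟫⁻ (Adj? x)

  ∈N[]⁺ : ∀ {i x y} → Adj x y → toℕ (level y) ≡ i → y ∈ N[ i ] x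
  ∈N[]⁺ xy eq = x∈p∩q⁺ (∈N⁺ xy , ∈V⁺ eq)

  ∈N[]⁻ : ∀ {i x y} → y ∈ N[ i ] x → Adj x y × toℕ (level y) ≡ i
  ∈N[]⁻ {i} {x} y∈ with x∈p∩q⁻ (N x) (V i) y∈
  ... | y∈N , y∈V = ∈N⁻ y∈N , ∈V⁻ y∈V

  cl : Subset order → Subset order
  cl S = S ∪ (⋂[ S ] N)

-- The sets of `V*` in terms of their top parts

module Star {q} (H : Multipartite (2 + q)) where
  open Multipartite H
  open Membership H

  Top : Fin order → Set
  Top x = toℕ (level x) ≡ suc q

  top? : ∀ x → Dec (Top x)
  top? x = toℕ (level x) ℕ.≟ suc q

  tops : Subset order → Subset order
  tops X = X ∩ V (suc q)

  ∈tops⁺ : ∀ {X x} → x ∈ X → Top x → x ∈ tops X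
  ∈tops⁺ x∈X tx = x∈p∩q⁺ (x∈X , ∈V⁺ tx)

  ∈tops⁻ : ∀ {X x} → x ∈ tops X → x ∈ X × Top x
  ∈tops⁻ {X} x∈ with x∈p∩q⁻ X (V (suc q)) x∈
  ... | x∈X , x∈V = x∈X , ∈V⁻ x∈V

  Top⇒¬Adj : ∀ {x y} → Top x → Top y → ¬ Adj x y
  Top⇒¬Adj tx ty xy = proper xy (Fin.toℕ-injective (trans tx (sym ty)))

  -- The clauses of `V*` see X only through its top part S. The guards on q say for how many levels
  -- a clause is present, so one record serves all four cases.
  record Good (S : Subset order) : Set where
    field
      size    : 2 ≤ ∣ S ∣
      common  : 2 ≤ ∣ ⋂[ S ] N ∣
      common₁ : 1 ≤ q → 2 ≤ ∣ ⋂[ S ] N[ q ] ∣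
      common₂ : 1 ≤ q → 2 ≤ ∣ ⋂[ S ] N[ commonLevel q ] ∣
      equal   : 2 ≤ q → ∀ {x y} → x ∈ S → y ∈ S → N[ equalLevel q ] x ≡ N[ equalLevel q ] y

  -- S is non-empty and the top level is independent, so no common neighbour of S is a top vertex.
  -- Hence the generating set of an element of `V⁺` can be recovered from it.
  tops-cl : ∀ {S} → S ⊆ V (suc q) → 2 ≤ ∣ S ∣ → tops (cl S) ≡ S
  tops-cl {S} S⊆V 2≤ with 1≤∣S∣⇒Nonempty (ℕ.≤-trans (s≤s z≤n) 2≤)
  ... | s , s∈S = ⊆-antisym ⊆S λ x∈S → ∈tops⁺ (x∈p∪q⁺ (inj₁ x∈S)) (∈V⁻ (S⊆V x∈S))
    where
    ⊆S : tops (cl S) ⊆ S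
    ⊆S x∈ with ∈tops⁻ {cl S} x∈
    ... | x∈cl , tx with x∈p∪q⁻ S _ x∈cl
    ... | inj₁ x∈S = x∈S
    ... | inj₂ x∈⋂ = contradiction (∈N⁻ (∈⋂⁻ {F = N} x∈⋂ s∈S)) (Top⇒¬Adj (∈V⁻ (S⊆V s∈S)) tx)

  V⁺⇒cl-tops : ∀ {X} → V⁺ H X → 2 ≤ ∣ tops X ∣ × 2 ≤ ∣ ⋂[ tops X ] N ∣ × X ≡ cl (tops X)
  V⁺⇒cl-tops (S , S⊆V , 2≤S , 2≤⋂ , refl) rewrite tops-cl S⊆V 2≤S = 2≤S , 2≤⋂ , refl

module _ where
  open Star

  V*⇒Good : ∀ {q} (H : Multipartite (2 + q)) {X} → V* H X →
            Good H (tops H X) × X ≡ Membership.cl H (tops H X)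
  V*⇒Good {0} H v⁺ with V⁺⇒cl-tops H v⁺
  ... | size , common , eq = record
    { size = size ; common = common ; common₁ = λ () ; common₂ = λ () ; equal = λ () } , eq
  V*⇒Good {1} H (v⁺ , c₁ , c₂) with V⁺⇒cl-tops H v⁺
  ... | size , common , eq = record
    { size = size ; common = common ; common₁ = λ _ → c₁ ; common₂ = λ _ → c₂
    ; equal = λ { (s≤s ()) } } , eq
  V*⇒Good {2} H (v⁺ , c₁ , c₂ , e) with V⁺⇒cl-tops H v⁺
  ... | size , common , eq = record
    { size = size ; common = common ; common₁ = λ _ → c₁ ; common₂ = λ _ → c₂
    ; equal = λ _ x∈ y∈ → e x∈ y∈ } , eq
  V*⇒Good {suc (suc (suc r))} H (v⁺ , c₁ , e , c₂) with V⁺⇒cl-tops H v⁺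
  ... | size , common , eq = record
    { size = size ; common = common ; common₁ = λ _ → c₁ ; common₂ = λ _ → c₂
    ; equal = λ _ x∈ y∈ → e x∈ y∈ } , eq

  Good⇒V* : ∀ {q} (H : Multipartite (2 + q)) {X} → V⁺ H X → Good H (tops H X) → V* H X
  Good⇒V* {0} H v⁺ good = v⁺
  Good⇒V* {1} H v⁺ good = v⁺ , Good.common₁ good (s≤s z≤n) , Good.common₂ good (s≤s z≤n)
  Good⇒V* {2} H v⁺ good = v⁺ , Good.common₁ good (s≤s z≤n) , Good.common₂ good (s≤s z≤n) ,
    λ x∈ y∈ → Good.equal good (s≤s (s≤s z≤n)) x∈ y∈
  Good⇒V* {suc (suc (suc r))} H v⁺ good = v⁺ , Good.common₁ good (s≤s z≤n) ,
    (λ x∈ y∈ → Good.equal good (s≤s (s≤s z≤n)) x∈ y∈) , Good.common₂ good (s≤s z≤n)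

module Closure {q} (H : Multipartite (2 + q)) where
  open Multipartite H
  open Membership H
  open Star H

  cl∈V* : ∀ {S} → S ⊆ V (suc q) → Good S → V* H (cl S)
  cl∈V* {S} S⊆V good = Good⇒V* H
    (S , S⊆V , Good.size good , Good.common good , refl)
    (subst Good (sym (tops-cl S⊆V (Good.size good))) good)

  -- Fewer vertices have more common neighbours, and `EqualN` passes to subsets; only the size of T
  -- has to be assumed.
  Good-antitone : ∀ {S T} → T ⊆ S → 2 ≤ ∣ T ∣ → Good S → Good T
  Good-antitone {S} {T} T⊆S 2≤T good = record
    { size    = 2≤T
    ; common  = mono N (Good.common good)
    ; common₁ = λ 1≤q → mono N[ q ] (Good.common₁ good 1≤q)
    ; common₂ = λ 1≤q → mono N[ commonLevel q ] (Good.common₂ good 1≤q)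
    ; equal   = λ 2≤q x∈ y∈ → Good.equal good 2≤q (T⊆S x∈) (T⊆S y∈)
    }
    where
    mono : ∀ F → 2 ≤ ∣ ⋂[ S ] F ∣ → 2 ≤ ∣ ⋂[ T ] F ∣
    mono F 2≤ = ℕ.≤-trans 2≤ (p⊆q⇒∣p∣≤∣q∣ (⋂-antitone {F = F} T⊆S))

  restrict : ∀ {X T} → V* H X → T ⊆ tops X → 2 ≤ ∣ T ∣ → V* H (cl T)
  restrict {X} v* T⊆ 2≤T = cl∈V* (λ x∈ → proj₂ (x∈p∩q⁻ X _ (T⊆ x∈)))
    (Good-antitone T⊆ 2≤T (proj₁ (V*⇒Good H v*)))

  module _ {X} (v* : V* H X) where
    private
      good = proj₁ (V*⇒Good H v*)
      X≡cl = proj₂ (V*⇒Good H v*)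

    ∃₂-tops : ∃₂ λ x y → (x ∈ X × Top x) × (y ∈ X × Top y) × y ≢ x
    ∃₂-tops with 2≤∣S∣⇒distinct (Good.size good)
    ... | x , y , x∈ , y∈ , y≢x = x , y , ∈tops⁻ x∈ , ∈tops⁻ y∈ , y≢x

    ∃-top : ∃ λ x → x ∈ X × Top x
    ∃-top = proj₁ ∃₂-tops , proj₁ (proj₂ (proj₂ ∃₂-tops))

    other-top : ∀ x → ∃ λ y → y ∈ X × Top y × y ≢ x
    other-top x with another (Good.size good) x
    ... | y , y∈ , y≢x = y , proj₁ (∈tops⁻ {X} y∈) , proj₂ (∈tops⁻ {X} y∈) , y≢x

    -- With three levels this is the clause at level q = 1; with more levels it is the clause at
    -- `commonLevel q`.
    common-V₁ : 1 ≤ q → 2 ≤ ∣ ⋂[ tops X ] N[ 1 ] ∣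
    common-V₁ = pick q (Good.common₁ good) (Good.common₂ good)
      where
      pick : ∀ r → (1 ≤ r → 2 ≤ ∣ ⋂[ tops X ] N[ r ] ∣) →
             (1 ≤ r → 2 ≤ ∣ ⋂[ tops X ] N[ commonLevel r ] ∣) →
             1 ≤ r → 2 ≤ ∣ ⋂[ tops X ] N[ 1 ] ∣
      pick 1             c₁ _  = c₁
      pick (suc (suc r)) _  c₂ = c₂

    ∈⇒Adj : ∀ {x u} → x ∈ X → Top x → u ∈ X → ¬ Top u → Adj x u
    ∈⇒Adj x∈ tx u∈ ¬tu with x∈p∪q⁻ (tops X) _ (subst (_ ∈_) X≡cl u∈)
    ... | inj₁ u∈tops = contradiction (proj₂ (∈tops⁻ {X} u∈tops)) ¬tu
    ... | inj₂ u∈⋂    = ∈N⁻ (∈⋂⁻ {F = N} u∈⋂ (∈tops⁺ x∈ tx))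

    -- Together with `∈⇒Adj`: the lower part of X is exactly the common neighbourhood of its top
    -- part.
    Adj⇒∈ : ∀ {u} → (∀ {x} → x ∈ X → Top x → Adj x u) → u ∈ X
    Adj⇒∈ {u} h = subst (u ∈_) (sym X≡cl) (x∈p∪q⁺ (inj₂ (∈⋂⁺ {F = N} λ x∈ →
      ∈N⁺ (h (proj₁ (∈tops⁻ {X} x∈)) (proj₂ (∈tops⁻ {X} x∈))))))

    equal⇒Adj : ∀ {x y u} → 2 ≤ q → x ∈ X → Top x → y ∈ X → Top y →
                toℕ (level u) ≡ equalLevel q → Adj x u → Adj y u
    equal⇒Adj 2≤q x∈ tx y∈ ty lu xu = proj₁ (∈N[]⁻
      (subst (_ ∈_) (Good.equal good 2≤q (∈tops⁺ x∈ tx) (∈tops⁺ y∈ ty)) (∈N[]⁺ xu lu)))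

  -- Adding z to the top part of X leaves its common neighbourhoods unchanged.
  absorb : ∀ {X z} → Maximal (V* H) X → Top z →
           (∀ {u} → u ∈ X → ¬ Top u → Adj z u) →
           (2 ≤ q → ∃ λ x → x ∈ X × Top x × N[ equalLevel q ] z ≡ N[ equalLevel q ] x) →
           z ∈ X
  absorb {X} {z} max tz joined compat =
    maximal-⊆ (V*? H) max v*S′ X⊆ (x∈p∪q⁺ (inj₁ (x∈p∪q⁺ (inj₂ (x∈⁅x⁆ z)))))
    where
    v*   = proj₁ max
    good = proj₁ (V*⇒Good H v*)
    S  = tops X
    S′ = S ∪ ⁅ z ⁆

    S′⊆V : S′ ⊆ V (suc q)
    S′⊆V x∈ with x∈p∪q⁻ S _ x∈
    ... | inj₁ x∈S = proj₂ (x∈p∩q⁻ X _ x∈S)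
    ... | inj₂ x∈z rewrite x∈⁅y⁆⇒x≡y z x∈z = ∈V⁺ tz

    joined′ : ∀ {u} → u ∈ ⋂[ S ] N → Adj z u
    joined′ u∈⋂ = joined
      (Adj⇒∈ v* λ x∈ tx → ∈N⁻ (∈⋂⁻ {F = N} u∈⋂ (∈tops⁺ x∈ tx)))
      λ tu → let x , x∈ , tx = ∃-top v* in
        Top⇒¬Adj tx tu (∈N⁻ (∈⋂⁻ {F = N} u∈⋂ (∈tops⁺ x∈ tx)))

    ⋂N⊆ : ⋂[ S ] N ⊆ ⋂[ S′ ] N
    ⋂N⊆ {u} u∈⋂ = ∈⋂⁺ {F = N} λ x∈ → lemma (x∈p∪q⁻ S _ x∈)
      where
      lemma : ∀ {x} → x ∈ S ⊎ x ∈ ⁅ z ⁆ → u ∈ N x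
      lemma (inj₁ x∈S) = ∈⋂⁻ {F = N} u∈⋂ x∈S
      lemma (inj₂ x∈z) rewrite x∈⁅y⁆⇒x≡y z x∈z = ∈N⁺ (joined′ u∈⋂)

    ⋂N[]⊆ : ∀ i → ⋂[ S ] N[ i ] ⊆ ⋂[ S′ ] N[ i ]
    ⋂N[]⊆ i u∈⋂ = ∈⋂⁺ {F = N[ i ]} λ x∈ → x∈p∩q⁺
      ( ∈⋂⁻ {F = N} (⋂N⊆ (∈⋂⁺ {F = N} λ x∈S → ∈N⁺ (proj₁ (∈N[]⁻ (∈⋂⁻ {F = N[ i ]} u∈⋂ x∈S))))) x∈
      , let x , x∈X , tx = ∃-top v* in
        ∈V⁺ (proj₂ (∈N[]⁻ (∈⋂⁻ {F = N[ i ]} u∈⋂ (∈tops⁺ x∈X tx)))) )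

    equal-x : (2≤q : 2 ≤ q) → ∀ {y} → y ∈ S′ →
              N[ equalLevel q ] y ≡ N[ equalLevel q ] (proj₁ (compat 2≤q))
    equal-x 2≤q y∈ with compat 2≤q | x∈p∪q⁻ S _ y∈
    ... | x , x∈ , tx , eq | inj₁ y∈S = Good.equal good 2≤q y∈S (∈tops⁺ x∈ tx)
    ... | x , x∈ , tx , eq | inj₂ y∈z rewrite x∈⁅y⁆⇒x≡y z y∈z = eq

    v*S′ : V* H (cl S′)
    v*S′ = cl∈V* S′⊆V record
      { size    = ℕ.≤-trans (Good.size good) (p⊆q⇒∣p∣≤∣q∣ (p⊆p∪q {p = S} ⁅ z ⁆))
      ; common  = ℕ.≤-trans (Good.common good) (p⊆q⇒∣p∣≤∣q∣ ⋂N⊆)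
      ; common₁ = λ 1≤q → ℕ.≤-trans (Good.common₁ good 1≤q) (p⊆q⇒∣p∣≤∣q∣ (⋂N[]⊆ q))
      ; common₂ = λ 1≤q → ℕ.≤-trans (Good.common₂ good 1≤q)
                    (p⊆q⇒∣p∣≤∣q∣ (⋂N[]⊆ (commonLevel q)))
      ; equal   = λ 2≤q x∈ y∈ → trans (equal-x 2≤q x∈) (sym (equal-x 2≤q y∈))
      }

    X⊆ : X ⊆ cl S′
    X⊆ {u} u∈ with top? u
    ... | yes tu = x∈p∪q⁺ (inj₁ (x∈p∪q⁺ (inj₁ (∈tops⁺ u∈ tu))))
    ... | no ¬tu = x∈p∪q⁺ (inj₂ (⋂N⊆ (∈⋂⁺ {F = N} λ x∈ →
      ∈N⁺ (∈⇒Adj v* (proj₁ (∈tops⁻ {X} x∈)) (proj₂ (∈tops⁻ {X} x∈)) u∈ ¬tu))))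

-- Hides the arithmetic of `splitAt` and covers both the incidence graph and the later
-- factorisations.
record AddsLevel {p m} (H : Multipartite p) (L : Fin m → Subset (Multipartite.order H))
                 (G : Multipartite (suc p)) : Set₁ where
  private
    module H = Multipartite H
    module G = Multipartite G
  field
    old           : Fin H.order → Fin G.order
    new           : Fin m → Fin G.order
    old⊎new       : ∀ v → (∃ λ x → old x ≡ v) ⊎ (∃ λ j → new j ≡ v)
    level-old     : ∀ x → toℕ (G.level (old x)) ≡ toℕ (H.level x)
    level-new     : ∀ j → toℕ (G.level (new j)) ≡ p
    -- An equality of types, because evaluating `splitAt` on both arguments turns adjacency into a
    -- clause of `E`; it is used through `subst id`.
    Adj-new       : ∀ j x → G.Adj (new j) (old x) ≡ (x ∈ L j)

  ¬Top-old : ∀ x → toℕ (G.level (old x)) ≢ p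
  ¬Top-old x eq = ℕ.<⇒≢ (Fin.toℕ<n (H.level x)) (trans (sym (level-old x)) eq)

  lower-old : ∀ {v} → toℕ (G.level v) ≢ p → ∃ λ x → old x ≡ v
  lower-old {v} ¬top with old⊎new v
  ... | inj₁ v-old      = v-old
  ... | inj₂ (j , refl) = contradiction (level-new j) ¬top

  top-new : ∀ {v} → toℕ (G.level v) ≡ p → ∃ λ j → new j ≡ v
  top-new {v} top with old⊎new v
  ... | inj₁ (x , refl) = contradiction top (¬Top-old x)
  ... | inj₂ v-new      = v-new

addLevel-addsLevel : ∀ {p} (H : Multipartite p) (Xs : List (Subset (Multipartite.order H)))
                     (ne : Xs ≢ List.[]) →
                     AddsLevel H (List.lookup Xs) (AddLevel.addLevel H Xs ne)
addLevel-addsLevel H Xs ne = record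
  { old           = _↑ˡ k
  ; new           = H.order ↑ʳ_
  ; old⊎new       = old⊎new
  ; level-old     = λ x → trans (cong (toℕ ∘ lev) (Fin.splitAt-↑ˡ H.order x k)) (Fin.toℕ-inject₁ _)
  ; level-new     = λ j → trans (cong (toℕ ∘ lev) (Fin.splitAt-↑ʳ H.order k j)) (Fin.toℕ-fromℕ _)
  ; Adj-new       = λ j x → cong₂ E (Fin.splitAt-↑ʳ H.order k j) (Fin.splitAt-↑ˡ H.order x k)
  }
  where
  module H = Multipartite H
  open AddLevel H Xs using (E; lev)
  k = length Xs

  old⊎new : ∀ v → (∃ λ x → x ↑ˡ k ≡ v) ⊎ (∃ λ j → H.order ↑ʳ j ≡ v)
  old⊎new v with splitAt H.order v in eq
  ... | inj₁ x = inj₁ (x , Fin.splitAt⁻¹-↑ˡ eq)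
  ... | inj₂ j = inj₂ (j , Fin.splitAt⁻¹-↑ʳ eq)

record IsCleanFactor {q} (H : Multipartite (2 + q)) (G : Multipartite (3 + q)) : Set₁ where
  field
    {size}      : ℕ
    L           : Fin size → Subset (Multipartite.order H)
    addsLevel   : AddsLevel H L G
    L-maximal   : ∀ j → Maximal (V* H) (L j)
    L-index     : ∀ {X} → Maximal (V* H) X → ∃ λ j → L j ≡ X
    L-injective : ∀ {i j} → L i ≡ L j → i ≡ j

  open AddsLevel addsLevel public

cleanFactor-isCleanFactor : ∀ {q} (H : Multipartite (2 + q)) (e : Effective H) →
                            IsCleanFactor H (cleanFactor H e)
cleanFactor-isCleanFactor H e = record
  { L           = List.lookup (maximals (V*? H))
  ; addsLevel   = addLevel-addsLevel H (maximals (V*? H)) e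
  ; L-maximal   = lookup-maximal (V*? H)
  ; L-index     = maximal-index (V*? H)
  ; L-injective = lookup-injective (maximals-unique (V*? H))
  }

-- The induction hypothesis for graphs with at least three levels. `separated` speaks of the level
-- that `EqualN` uses in `V*` of the next graph, so that this clause can identify least vertices.
record Regular {q} (H : Multipartite (2 + q)) : Set where
  open Multipartite H
  open Star H
  field
    antichain : ∀ {x y} → Top x → Top y → (∀ {u} → ¬ Top u → Adj x u → Adj y u) → x ≡ y
    separated : ∀ {x y} → Top x → Top y →
                (∀ {u} → toℕ (level u) ≡ equalLevel (suc q) → Adj x u → Adj y u) →
                (∀ {u} → toℕ (level u) ≡ equalLevel (suc q) → Adj y u → Adj x u) → x ≡ y
    least     : ∀ {X} → Maximal (V* H) X → ∃ λ y → y ∈ X × Top y ×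
                (∀ {u} → toℕ (level u) ≢ 1 → ¬ Top u → Adj y u → u ∈ X)

-- Regularity of clean-factor graphs

module Step {q} {H : Multipartite (2 + q)} {G : Multipartite (3 + q)}
            (factor : IsCleanFactor H G) where
  open IsCleanFactor factor public
  private
    module H where
      open Multipartite H public
      open Star H public
      open Membership H public
      open Closure H public

  private
    module G where
      open Multipartite G public
      open Star G public
      open Membership G public
      open Closure G public

  L-v* : ∀ j → V* H (L j)
  L-v* = proj₁ ∘ L-maximal

  L-⊆⇒≡ : ∀ {i j} → L i ⊆ L j → i ≡ j
  L-⊆⇒≡ {i} {j} Li⊆Lj = L-injective
    (⊆-antisym Li⊆Lj (maximal-⊆ (V*? H) (L-maximal i) (L-v* j) Li⊆Lj))

  new-adj⁺ : ∀ {j x} → x ∈ L j → G.Adj (new j) (old x)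
  new-adj⁺ {j} {x} = subst id (sym (Adj-new j x))

  new-adj⁻ : ∀ {j x} → G.Adj (new j) (old x) → x ∈ L j
  new-adj⁻ {j} {x} = subst id (Adj-new j x)

  antichain : ∀ {x y} → G.Top x → G.Top y → (∀ {u} → ¬ G.Top u → G.Adj x u → G.Adj y u) → x ≡ y
  antichain tx ty sub with top-new tx | top-new ty
  ... | i , refl | j , refl =
    cong new (L-⊆⇒≡ λ {u} u∈ → new-adj⁻ (sub (¬Top-old u) (new-adj⁺ u∈)))

  low : ∀ {x} → q ≡ 0 → ¬ H.Top x → toℕ (H.level x) ≡ 0
  low {x} refl ¬tx = ℕ.n<1⇒n≡0 (ℕ.≤∧≢⇒< (s≤s⁻¹ (Fin.toℕ<n (H.level x))) ¬tx)

  -- z is joined to the lower part of `L j`, hence to that of `L i`, so `absorb` applies. A shared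
  -- top vertex x supplies the `EqualN` condition, since z and x satisfy it inside `L j`.
  absorb-L : ∀ {i j z} → z ∈ L j → H.Top z → (∀ {u} → ¬ H.Top u → u ∈ L i → u ∈ L j) →
             (2 ≤ q → ∃ λ x → x ∈ L i × x ∈ L j × H.Top x) → z ∈ L i
  absorb-L {i} {j} z∈ tz sub shared = H.absorb (L-maximal i) tz
    (λ u∈ ¬tu → H.∈⇒Adj (L-v* j) z∈ tz (sub ¬tu u∈) ¬tu)
    λ 2≤q → let x , x∈i , x∈j , tx = shared 2≤q in
      x , x∈i , tx , Good.equal (proj₁ (V*⇒Good H (L-v* j))) 2≤q
        (H.∈tops⁺ z∈ tz) (H.∈tops⁺ x∈j tx)
    where open Star

  -- If H has two levels, level 0 contains the whole lower part of each `L j`, and sets with equal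
  -- lower parts absorb each other's top vertices. Otherwise the level in question is the top level
  -- of H, and top parts determine lower parts.
  separated : ∀ {x y} → G.Top x → G.Top y →
              (∀ {u} → toℕ (G.level u) ≡ equalLevel (2 + q) → G.Adj x u → G.Adj y u) →
              (∀ {u} → toℕ (G.level u) ≡ equalLevel (2 + q) → G.Adj y u → G.Adj x u) → x ≡ y
  separated tx ty x⊆y y⊆x with top-new tx | top-new ty
  ... | i , refl | j , refl = cong new (L-⊆⇒≡ (sub q refl x⊆y y⊆x))
    where
    sub : ∀ r → q ≡ r →
          (∀ {u} → toℕ (G.level u) ≡ equalLevel (2 + r) → G.Adj (new i) u → G.Adj (new j) u) →
          (∀ {u} → toℕ (G.level u) ≡ equalLevel (2 + r) → G.Adj (new j) u → G.Adj (new i) u) →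
          L i ⊆ L j
    sub zero q≡0 i⊆j j⊆i {u} u∈ with H.top? u
    ... | no ¬tu = new-adj⁻ (i⊆j (trans (level-old u) (low q≡0 ¬tu)) (new-adj⁺ u∈))
    ... | yes tu = absorb-L u∈ tu
      (λ {v} ¬tv v∈ → new-adj⁻ (j⊆i (trans (level-old v) (low q≡0 ¬tv)) (new-adj⁺ v∈)))
      λ 2≤q → contradiction (subst (2 ≤_) q≡0 2≤q) λ ()
    sub (suc r) refl i⊆j j⊆i {u} u∈ with H.top? u
    ... | yes tu = new-adj⁻ (i⊆j (trans (level-old u) tu) (new-adj⁺ u∈))
    ... | no ¬tu = H.Adj⇒∈ (L-v* j) λ {x} x∈ tx → H.∈⇒Adj (L-v* i)
      (new-adj⁻ (j⊆i (trans (level-old x) tx) (new-adj⁺ x∈))) tx u∈ ¬tu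

  module _ {X} (max : Maximal (V* G) X) where
    private
      v* = proj₁ max

    -- By `trace⊆L` and `∈-trace` this is the intersection of all `L j` with `new j ∈ X`.
    trace : Subset H.order
    trace = ⟪ (λ x → old x ∈? X) ⟫

    ∈trace⁺ : ∀ {x} → old x ∈ X → x ∈ trace
    ∈trace⁺ = ∈⟪⟫⁺ (λ x → old x ∈? X)

    ∈trace⁻ : ∀ {x} → x ∈ trace → old x ∈ X
    ∈trace⁻ = ∈⟪⟫⁻ (λ x → old x ∈? X)

    trace⊆L : ∀ {j} → new j ∈ X → trace ⊆ L j
    trace⊆L {j} j∈ {u} u∈ = new-adj⁻ (G.∈⇒Adj v* j∈ (level-new j) (∈trace⁻ u∈) (¬Top-old u))

    ∈-trace : ∀ {u} → (∀ {j} → new j ∈ X → u ∈ L j) → u ∈ trace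
    ∈-trace h = ∈trace⁺ (G.Adj⇒∈ v* λ x∈ tx → lemma x∈ (top-new tx))
      where
      lemma : ∀ {x} → x ∈ X → (∃ λ j → new j ≡ x) → G.Adj x (old _)
      lemma x∈ (j , refl) = new-adj⁺ (h x∈)

    ∃-new : ∃ λ j → new j ∈ X
    ∃-new with G.∃-top v*
    ... | x , x∈ , tx with top-new tx
    ... | j , refl = j , x∈

    -- A common neighbour of the top part of X is an old vertex that lies in all these `L j`. This
    -- carries the clauses `CommonN≥2` from G down to H.
    trace-2≤ : ∀ {i} → 2 ≤ ∣ ⋂[ G.tops X ] G.N[ i ] ∣ → 2 ≤ ∣ trace ∩ H.V i ∣
    trace-2≤ {i} = image-2≤ old onto
      where
      j₀ = proj₁ ∃-new

      new∈tops : ∀ {j} → new j ∈ X → new j ∈ G.tops X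
      new∈tops {j} j∈ = G.∈tops⁺ j∈ (level-new j)

      onto : ∀ {y} → y ∈ ⋂[ G.tops X ] G.N[ i ] → ∃ λ x → x ∈ trace ∩ H.V i × old x ≡ y
      onto {y} y∈ with G.∈N[]⁻ (∈⋂⁻ {F = G.N[ i ]} y∈ (new∈tops (proj₂ ∃-new)))
      ... | adj , ly with lower-old (λ ty → G.Top⇒¬Adj (level-new j₀) ty adj)
      ... | x , refl = x , x∈p∩q⁺
        ( ∈-trace (λ j∈ → new-adj⁻ (proj₁ (G.∈N[]⁻ (∈⋂⁻ {F = G.N[ i ]} y∈ (new∈tops j∈)))))
        , H.∈V⁺ (trans (sym (level-old x)) ly) ) , refl

    -- Maximality of X lets it absorb `new w`. The last hypothesis gives equal neighbourhoods for
    -- `EqualN`, a clause that `V*` of G has once 1 ≤ q.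
    new∈ : ∀ w → trace ⊆ L w →
           (1 ≤ q → ∃ λ j → new j ∈ X ×
             (∀ {u} → toℕ (H.level u) ≡ equalLevel (suc q) → u ∈ L w → u ∈ L j) ×
             (∀ {u} → toℕ (H.level u) ≡ equalLevel (suc q) → u ∈ L j → u ∈ L w)) →
           new w ∈ X
    new∈ w trace⊆ compat = G.absorb max (level-new w) joined compat′
      where
      joined : ∀ {u} → u ∈ X → ¬ G.Top u → G.Adj (new w) u
      joined u∈ ¬tu with lower-old ¬tu
      ... | x , refl = new-adj⁺ (trace⊆ (∈trace⁺ u∈))

      N[]-mono : ∀ {i j} → (∀ {u} → toℕ (H.level u) ≡ equalLevel (suc q) → u ∈ L i → u ∈ L j) →
                 G.N[ equalLevel (suc q) ] (new i) ⊆ G.N[ equalLevel (suc q) ] (new j)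
      N[]-mono {i} {j} sub {u} u∈ with G.∈N[]⁻ u∈
      ... | adj , lu with lower-old (λ tu → G.Top⇒¬Adj (level-new i) tu adj)
      ... | x , refl = G.∈N[]⁺
        (new-adj⁺ {j} {x} (sub {x} (trans (sym (level-old x)) lu) (new-adj⁻ {i} {x} adj))) lu

      compat′ : 2 ≤ suc q → ∃ λ x → x ∈ X × G.Top x ×
                G.N[ equalLevel (suc q) ] (new w) ≡ G.N[ equalLevel (suc q) ] x
      compat′ 2≤ with compat (s≤s⁻¹ 2≤)
      ... | j , j∈ , w⊆j , j⊆w = new j , j∈ , level-new j ,
        ⊆-antisym (N[]-mono {w} {j} w⊆j) (N[]-mono {j} {w} j⊆w)

    Least : Set
    Least = ∃ λ y → y ∈ X × G.Top y ×
            (∀ {u} → toℕ (G.level u) ≢ 1 → ¬ G.Top u → G.Adj y u → u ∈ X)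

    least-new : ∀ w → new w ∈ X →
                (∀ {u} → toℕ (H.level u) ≢ 1 → u ∈ L w → u ∈ trace) → Least
    least-new w w∈ sub = new w , w∈ , level-new w , λ {u} ≢1 ¬tu adj → lemma ≢1 adj (lower-old ¬tu)
      where
      lemma : ∀ {u} → toℕ (G.level u) ≢ 1 → G.Adj (new w) u → (∃ λ x → old x ≡ u) → u ∈ X
      lemma ≢1 adj (x , refl) = ∈trace⁻ (sub (≢1 ∘ trans (level-old x)) (new-adj⁻ adj))

    index-above : ∀ {Y} → V* H Y → ∃ λ w → Y ⊆ L w
    index-above v*Y with ∃-maximal-above (V*? H) v*Y
    ... | Z , maxZ , Y⊆Z with L-index maxZ
    ... | w , refl = w , Y⊆Z

    -- T is the set of all level-1 vertices joined to every vertex of O. It includes the top part of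
    -- each `L j` with `new j ∈ X`, so a set `L w` above `cl T` has its lower part in all of them.
    least-base : q ≡ 0 → Least
    least-base q≡0 = let w , clT⊆ = index-above v*T in
      least-new w (new∈ w (trace⊆ w clT⊆) λ 1≤q → contradiction (subst (1 ≤_) q≡0 1≤q) λ ())
        (sub w clT⊆)
      where
      j₀ = proj₁ ∃-new
      j₀∈ = proj₂ ∃-new

      O = trace ∩ H.V 0
      T = H.V (suc q) ∩ (⋂[ O ] H.N)

      O⊆ : ∀ {u} → u ∈ O → u ∈ trace × toℕ (H.level u) ≡ 0
      O⊆ u∈ with x∈p∩q⁻ trace (H.V 0) u∈
      ... | u∈t , u∈V = u∈t , H.∈V⁻ u∈V

      T⊆ : ∀ {x} → x ∈ T → H.Top x × x ∈ ⋂[ O ] H.N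
      T⊆ x∈ with x∈p∩q⁻ (H.V (suc q)) _ x∈
      ... | x∈V , x∈⋂ = H.∈V⁻ x∈V , x∈⋂

      low⇒¬Top : ∀ {u} → toℕ (H.level u) ≡ 0 → ¬ H.Top u
      low⇒¬Top l₀ l₁ with () ← trans (sym l₀) l₁

      L⊆T : ∀ {j x} → new j ∈ X → x ∈ L j → H.Top x → x ∈ T
      L⊆T {j} j∈ x∈ tx = x∈p∩q⁺ (H.∈V⁺ tx , ∈⋂⁺ {F = H.N} λ u∈ →
        let u∈t , lu = O⊆ u∈ in
        H.∈N⁺ (H.symm (H.∈⇒Adj (L-v* j) x∈ tx (trace⊆L j∈ u∈t) (low⇒¬Top lu))))

      O⊆⋂T : O ⊆ ⋂[ T ] H.N
      O⊆⋂T u∈ = ∈⋂⁺ {F = H.N} λ x∈ → H.∈N⁺ (H.symm (H.∈N⁻ (∈⋂⁻ {F = H.N} (proj₂ (T⊆ x∈)) u∈)))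

      common-V₀ : 2 ≤ ∣ ⋂[ G.tops X ] G.N[ 0 ] ∣
      common-V₀ = subst (λ i → 2 ≤ ∣ ⋂[ G.tops X ] G.N[ i ] ∣) (cong (commonLevel ∘ suc) q≡0)
        (Star.Good.common₂ (proj₁ (V*⇒Good G v*)) (s≤s z≤n))

      v*T : V* H (H.cl T)
      v*T = H.cl∈V* (λ x∈ → proj₁ (x∈p∩q⁻ (H.V (suc q)) _ x∈)) record
        { size    = ℕ.≤-trans (Star.Good.size (proj₁ (V*⇒Good H (L-v* j₀))))
            (p⊆q⇒∣p∣≤∣q∣ λ x∈ → L⊆T j₀∈ (proj₁ (H.∈tops⁻ {L j₀} x∈)) (proj₂ (H.∈tops⁻ {L j₀} x∈)))
        ; common  = ℕ.≤-trans (trace-2≤ common-V₀) (p⊆q⇒∣p∣≤∣q∣ O⊆⋂T)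
        ; common₁ = λ 1≤q → contradiction (subst (1 ≤_) q≡0 1≤q) λ ()
        ; common₂ = λ 1≤q → contradiction (subst (1 ≤_) q≡0 1≤q) λ ()
        ; equal   = λ 2≤q → contradiction (subst (2 ≤_) q≡0 2≤q) λ ()
        }

      module _ (w : Fin size) (clT⊆ : H.cl T ⊆ L w) where

        trace⊆ : trace ⊆ L w
        trace⊆ {u} u∈ with H.top? u
        ... | yes tu = clT⊆ (x∈p∪q⁺ (inj₁ (L⊆T j₀∈ (trace⊆L j₀∈ u∈) tu)))
        ... | no ¬tu = clT⊆ (x∈p∪q⁺ (inj₂ (O⊆⋂T (x∈p∩q⁺ (u∈ , H.∈V⁺ (low q≡0 ¬tu))))))

        sub : ∀ {u} → toℕ (H.level u) ≢ 1 → u ∈ L w → u ∈ trace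
        -- u is on level 0. All top vertices of `L j` belong to T, hence to `L w`, and are therefore
        -- joined to u.
        sub ≢1 u∈ = ∈-trace λ {j} j∈ → H.Adj⇒∈ (L-v* j) λ x∈ tx →
          H.∈⇒Adj (L-v* w) (clT⊆ (x∈p∪q⁺ (inj₁ (L⊆T j∈ x∈ tx)))) tx u∈
            λ tu → ≢1 (trans tu (cong suc q≡0))

    -- By `min≡y` the sets `L j` with `new j ∈ X` share one least vertex y. It lies in T, so outside
    -- level 1 the lower part of a set `L w` above `cl T` consists of neighbours of y, and these
    -- belong to every such `L j`.
    least-step : 1 ≤ q → Regular H → Least
    least-step 1≤q reg = let w , clT⊆ = index-above v*T in
      least-new w
        -- `L w` and `L j₀` agree on level k: one inclusion goes through y, the other through the
        -- common neighbourhood of T.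
        (new∈ w (trace⊆ w clT⊆) λ _ → j₀ , j₀∈ ,
          (λ lu u∈ → y-least j₀∈ (e≢1 lu) (e¬top lu)
            (H.∈⇒Adj (L-v* w) (clT⊆ (x∈p∪q⁺ (inj₁ y∈T))) ty u∈ (e¬top lu))) ,
          λ lu u∈ → clT⊆ (x∈p∪q⁺ (inj₂ (lower⊆ j₀∈ u∈ (e¬top lu)))))
        (sub w clT⊆)
      where
      j₀ = proj₁ ∃-new
      j₀∈ = proj₂ ∃-new
      k = equalLevel (suc q)

      e≢1 : ∀ {u} → toℕ (H.level u) ≡ k → toℕ (H.level u) ≢ 1
      e≢1 lu l₁ = equalLevel≢1 (suc q) (trans (sym lu) l₁)

      e¬top : ∀ {u} → toℕ (H.level u) ≡ k → ¬ H.Top u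
      e¬top lu tu = ℕ.<⇒≢ (equalLevel< 1≤q) (trans (sym lu) tu)

      min : ∀ j → ∃ λ y → y ∈ L j × H.Top y ×
            (∀ {u} → toℕ (H.level u) ≢ 1 → ¬ H.Top u → H.Adj y u → u ∈ L j)
      min j = Regular.least reg (L-maximal j)

      y = proj₁ (min j₀)
      ty = proj₁ (proj₂ (proj₂ (min j₀)))

      -- By the EqualN clause the least elements of the sets L j with new j ∈ X
      -- have the same neighbours on level k, which determines them.
      min-mono : ∀ {i j} → new i ∈ X → new j ∈ X → ∀ {u} → toℕ (H.level u) ≡ k →
                 H.Adj (proj₁ (min i)) u → H.Adj (proj₁ (min j)) u
      min-mono {i} {j} i∈ j∈ {u} lu adj with min i | min j
      ... | yi , _ , _ , yi-least | yj , yj∈ , tyj , _ = H.∈⇒Adj (L-v* j) yj∈ tyj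
        (new-adj⁻ (G.equal⇒Adj v* (s≤s 1≤q) i∈ (level-new i) j∈ (level-new j)
          (trans (level-old u) lu) (new-adj⁺ (yi-least (e≢1 lu) (e¬top lu) adj))))
        (e¬top lu)

      min≡y : ∀ {j} → new j ∈ X → proj₁ (min j) ≡ y
      min≡y {j} j∈ = Regular.separated reg (proj₁ (proj₂ (proj₂ (min j)))) ty
        (min-mono j∈ j₀∈) (min-mono j₀∈ j∈)

      y∈L : ∀ {j} → new j ∈ X → y ∈ L j
      y∈L {j} j∈ = subst (_∈ L j) (min≡y j∈) (proj₁ (proj₂ (min j)))

      y-least : ∀ {j} → new j ∈ X → ∀ {u} → toℕ (H.level u) ≢ 1 → ¬ H.Top u →
                H.Adj y u → u ∈ L j
      y-least {j} j∈ ≢1 ¬tu adj = proj₂ (proj₂ (proj₂ (min j))) ≢1 ¬tu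
        (subst (λ z → H.Adj z _) (sym (min≡y j∈)) adj)

      T = trace ∩ H.V (suc q)

      T⊆ : ∀ {x} → x ∈ T → x ∈ trace × H.Top x
      T⊆ = H.∈tops⁻ {trace}

      y∈T : y ∈ T
      y∈T = H.∈tops⁺ (∈-trace y∈L) ty

      v*T : V* H (H.cl T)
      v*T = H.restrict (L-v* j₀)
        (λ x∈ → H.∈tops⁺ (trace⊆L j₀∈ (proj₁ (T⊆ x∈))) (proj₂ (T⊆ x∈)))
        -- The first common-neighbour clause of G is at level `suc q`, the top level of H.
        (trace-2≤ (Star.Good.common₁ (proj₁ (V*⇒Good G v*)) (s≤s z≤n)))

      lower⊆ : ∀ {j u} → new j ∈ X → u ∈ L j → ¬ H.Top u → u ∈ ⋂[ T ] H.N
      lower⊆ {j} j∈ u∈ ¬tu = ∈⋂⁺ {F = H.N} λ x∈ →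
        H.∈N⁺ (H.∈⇒Adj (L-v* j) (trace⊆L j∈ (proj₁ (T⊆ x∈))) (proj₂ (T⊆ x∈)) u∈ ¬tu)

      module _ (w : Fin size) (clT⊆ : H.cl T ⊆ L w) where

        trace⊆ : trace ⊆ L w
        trace⊆ {u} u∈ with H.top? u
        ... | yes tu = clT⊆ (x∈p∪q⁺ (inj₁ (H.∈tops⁺ u∈ tu)))
        ... | no ¬tu = clT⊆ (x∈p∪q⁺ (inj₂ (lower⊆ j₀∈ (trace⊆L j₀∈ u∈) ¬tu)))

        sub : ∀ {u} → toℕ (H.level u) ≢ 1 → u ∈ L w → u ∈ trace
        sub {u} ≢1 u∈ with H.top? u
        ... | no ¬tu = ∈-trace λ j∈ → y-least j∈ ≢1 ¬tu
          (H.∈⇒Adj (L-v* w) (clT⊆ (x∈p∪q⁺ (inj₁ y∈T))) ty u∈ ¬tu)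
        -- The lower part of `L j` lies in `L w`, and y is the shared top vertex.
        ... | yes tu = ∈-trace λ {j} j∈ → absorb-L u∈ tu
          (λ ¬tv v∈ → clT⊆ (x∈p∪q⁺ (inj₂ (lower⊆ j∈ v∈ ¬tv))))
          λ _ → y , y∈L j∈ , clT⊆ (x∈p∪q⁺ (inj₁ y∈T)) , ty

  regular-base : q ≡ 0 → Regular G
  regular-base q≡0 = record
    { antichain = antichain ; separated = separated ; least = λ max → least-base max q≡0 }

  regular-step : 1 ≤ q → Regular H → Regular G
  regular-step 1≤q reg = record
    { antichain = antichain ; separated = separated ; least = λ max → least-step max 1≤q reg }

-- Codes of the vertices

module Codes {n k : ℕ} (C : Fin k → Subset n) where

  through : Fin n → Subset k
  through v = ⟪ (λ j → v ∈? C j) ⟫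

  ∈through⁺ : ∀ {v j} → v ∈ C j → j ∈ through v
  ∈through⁺ {v} = ∈⟪⟫⁺ (λ j → v ∈? C j)

  ∈through⁻ : ∀ {v j} → j ∈ through v → v ∈ C j
  ∈through⁻ {v} = ∈⟪⟫⁻ (λ j → v ∈? C j)

  InAll : Subset k → Fin n → Set
  InAll κ v = ∀ {j} → j ∈ κ → v ∈ C j

  -- The closed sets of the Galois connection between sets of vertices and sets of cliques; they are
  -- determined by their intersections.
  Closed : Subset k → Set
  Closed κ = ∀ {d} → (∀ {v} → InAll κ v → v ∈ C d) → d ∈ κ

  Code : Set
  Code = Fin n × List (Subset k)

  -- The chain is prefixed with `Subset.⊥` to make its first set non-empty.
  record Valid (code : Code) : Set where
    field
      ascending : Linked _⊂_ (Subset.⊥ ∷ proj₂ code)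
      closed    : All Closed (proj₂ code)
      within    : All (_⊆ through (proj₁ code)) (proj₂ code)

  Valid-∷ : ∀ {v κ κ′ κs} → Nonempty κ → Closed κ → κ ⊂ κ′ →
            Valid (v , κ′ ∷ κs) → Valid (v , κ ∷ κ′ ∷ κs)
  Valid-∷ (i , i∈) closed κ⊂κ′ valid with Valid.ascending valid | Valid.within valid
  ... | _ ∷ link | κ′⊆ ∷ κs⊆ = record
    { ascending = (⊆-min _ , i , i∈ , ∉⊥) ∷ κ⊂κ′ ∷ link
    ; closed    = closed ∷ Valid.closed valid
    ; within    = κ′⊆ ∘ proj₁ κ⊂κ′ ∷ κ′⊆ ∷ κs⊆
    }

  record Coding {q} (H : Multipartite (2 + q)) : Set where
    open Multipartite H
    field
      clique         : Fin k → Fin order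
      clique-level   : ∀ j → toℕ (level (clique j)) ≡ 1
      clique-onto    : ∀ {x} → toℕ (level x) ≡ 1 → ∃ λ j → clique j ≡ x
      code           : Fin order → Code
      code-injective : ∀ {x y} → code x ≡ code y → x ≡ y
      code-valid     : ∀ x → Valid (code x)

    cliquesIn : Subset order → Subset k
    cliquesIn X = ⟪ (λ j → clique j ∈? X) ⟫

    ∈cliquesIn⁺ : ∀ {X j} → clique j ∈ X → j ∈ cliquesIn X
    ∈cliquesIn⁺ {X} = ∈⟪⟫⁺ (λ j → clique j ∈? X)

    ∈cliquesIn⁻ : ∀ {X j} → j ∈ cliquesIn X → clique j ∈ X
    ∈cliquesIn⁻ {X} = ∈⟪⟫⁻ (λ j → clique j ∈? X)

  -- Codes have length at most q and top vertices attain it, so a code with one more set is fresh.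
  -- The first set of a top code is known, which allows a smaller one to be put before it.
  record TopCoded {q} {H : Multipartite (2 + q)} (coding : Coding H) : Set where
    open Multipartite H
    open Star H
    open Coding coding
    field
      length-≤ : ∀ x → length (proj₂ (code x)) ≤ q
      top-code : ∀ {x} → Top x → ∃ λ κs →
                 proj₂ (code x) ≡ cliquesIn (N x) ∷ κs × suc (length κs) ≡ q

  module Extension {q} {H : Multipartite (2 + q)} {G : Multipartite (3 + q)}
                   (factor : IsCleanFactor H G) (coding : Coding H)
                   (newCode : Fin (IsCleanFactor.size factor) → Code)
                   (newCode-injective : ∀ {i j} → newCode i ≡ newCode j → i ≡ j)
                   (newCode-fresh : ∀ j x → newCode j ≢ Coding.code coding x)
                   (newCode-valid : ∀ j → Valid (newCode j)) where
    open IsCleanFactor factor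
    private
      module H = Multipartite H
      module G = Multipartite G
      module GM = Membership G
      open Coding coding

    Case : Fin G.order → Set
    Case v = (∃ λ x → old x ≡ v) ⊎ (∃ λ j → new j ≡ v)

    codeOf : ∀ {v} → Case v → Code
    codeOf (inj₁ (x , _)) = code x
    codeOf (inj₂ (j , _)) = newCode j

    codeOf-injective : ∀ {v w} (a : Case v) (b : Case w) → codeOf a ≡ codeOf b → v ≡ w
    codeOf-injective (inj₁ (x , refl)) (inj₁ (y , refl)) eq = cong old (code-injective eq)
    codeOf-injective (inj₁ (x , refl)) (inj₂ (j , refl)) eq =
      contradiction (sym eq) (newCode-fresh j x)
    codeOf-injective (inj₂ (j , refl)) (inj₁ (x , refl)) eq =
      contradiction eq (newCode-fresh j x)
    codeOf-injective (inj₂ (i , refl)) (inj₂ (j , refl)) eq = cong new (newCode-injective eq)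

    codeOf-valid : ∀ {v} (a : Case v) → Valid (codeOf a)
    codeOf-valid (inj₁ (x , _)) = code-valid x
    codeOf-valid (inj₂ (j , _)) = newCode-valid j

    extended : Coding G
    extended = record
      { clique         = old ∘ clique
      ; clique-level   = λ j → trans (level-old (clique j)) (clique-level j)
      ; clique-onto    = onto
      ; code           = codeOf ∘ old⊎new
      ; code-injective = λ {v} {w} → codeOf-injective (old⊎new v) (old⊎new w)
      ; code-valid     = codeOf-valid ∘ old⊎new
      }
      where
      onto : ∀ {v} → toℕ (G.level v) ≡ 1 → ∃ λ j → old (clique j) ≡ v
      onto lv with lower-old (λ top → ℕ.<⇒≢ (s≤s (s≤s z≤n)) (trans (sym lv) top))
      ... | x , refl with clique-onto (trans (sym (level-old x)) lv)
      ... | j , refl = j , refl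

    topCoded : (∀ x → length (proj₂ (code x)) ≤ suc q) →
               (∀ j → ∃ λ κs → proj₂ (newCode j) ≡ cliquesIn (L j) ∷ κs × length κs ≡ q) →
               TopCoded extended
    topCoded old-≤ new-head = record
      { length-≤ = λ v → length-codeOf (old⊎new v)
      ; top-code = λ {v} → top (old⊎new v)
      }
      where
      length-codeOf : ∀ {v} (a : Case v) → length (proj₂ (codeOf a)) ≤ suc q
      length-codeOf (inj₁ (x , _)) = old-≤ x
      length-codeOf (inj₂ (j , _)) with new-head j
      ... | κs , eq , len = ℕ.≤-reflexive (trans (cong length eq) (cong suc len))

      cliques≡ : ∀ j → cliquesIn (L j) ≡ Coding.cliquesIn extended (G.N (new j))
      cliques≡ j = ⊆-antisym
        (λ i∈ → Coding.∈cliquesIn⁺ extended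
          (GM.∈N⁺ (subst id (sym (Adj-new j _)) (∈cliquesIn⁻ {L j} i∈))))
        (λ i∈ → ∈cliquesIn⁺ (subst id (Adj-new j _)
          (GM.∈N⁻ (Coding.∈cliquesIn⁻ extended {G.N (new j)} i∈))))

      top : ∀ {v} (a : Case v) → Star.Top G v → ∃ λ κs →
            proj₂ (codeOf a) ≡ Coding.cliquesIn extended (G.N v) ∷ κs × suc (length κs) ≡ suc q
      top (inj₁ (x , refl)) tv = contradiction tv (¬Top-old x)
      top (inj₂ (j , refl)) tv with new-head j
      ... | κs , eq , len = κs , trans eq (cong (_∷ κs) (cliques≡ j)) , cong suc len

  -- Codes of the vertices of level 3 and above

  module CodingStep {q} {H : Multipartite (2 + q)} {G : Multipartite (3 + q)}
                    (factor : IsCleanFactor H G) (1≤q : 1 ≤ q) (regular : Regular H)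
                    (coding : Coding H) (topCoded : TopCoded coding) where
    open Step factor
    private
      module H where
        open Multipartite H public
        open Star H public
        open Membership H public
        open Closure H public
    open Coding coding
    open TopCoded topCoded

    min : ∀ j → ∃ λ y → y ∈ L j × H.Top y ×
          (∀ {u} → toℕ (H.level u) ≢ 1 → ¬ H.Top u → H.Adj y u → u ∈ L j)
    min j = Regular.least regular (L-maximal j)

    y : Fin size → Fin H.order
    y j = proj₁ (min j)

    y∈ : ∀ j → y j ∈ L j
    y∈ j = proj₁ (proj₂ (min j))

    y-top : ∀ j → H.Top (y j)
    y-top j = proj₁ (proj₂ (proj₂ (min j)))

    newCode : Fin size → Code
    newCode j = proj₁ (code (y j)) , cliquesIn (L j) ∷ proj₂ (code (y j))

    clique-¬Top : ∀ i → ¬ H.Top (clique i)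
    clique-¬Top i top = ℕ.<⇒≢ (s≤s 1≤q) (trans (sym (clique-level i)) top)

    below : ∀ {i j} → y i ≡ y j → cliquesIn (L i) ≡ cliquesIn (L j) →
            ∀ {u} → ¬ H.Top u → u ∈ L i → u ∈ L j
    below {i} {j} yi≡yj κ≡ {u} ¬tu u∈ with toℕ (H.level u) ℕ.≟ 1
    ... | no  ≢1 = proj₂ (proj₂ (proj₂ (min j))) ≢1 ¬tu
      (subst (λ z → H.Adj z u) yi≡yj (H.∈⇒Adj (L-v* i) (y∈ i) (y-top i) u∈ ¬tu))
    ... | yes ≡1 with clique-onto ≡1
    ... | d , refl = ∈cliquesIn⁻ {L j} (subst (d ∈_) κ≡ (∈cliquesIn⁺ u∈))

    -- L j is recovered from its least vertex, which knows its lower part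
    -- outside level 1, together with its cliques.
    L-⊆ : ∀ {i j} → y i ≡ y j → cliquesIn (L i) ≡ cliquesIn (L j) → L i ⊆ L j
    L-⊆ {i} {j} yi≡yj κ≡ {u} u∈ with H.top? u
    ... | no ¬tu = below yi≡yj κ≡ ¬tu u∈
    ... | yes tu = absorb-L u∈ tu (below (sym yi≡yj) (sym κ≡))
      λ _ → y i , subst (_∈ L j) (sym yi≡yj) (y∈ j) , y∈ i , y-top i

    newCode-injective : ∀ {i j} → newCode i ≡ newCode j → i ≡ j
    newCode-injective {i} {j} eq = L-⊆⇒≡ (L-⊆
      (code-injective (cong₂ _,_ (cong proj₁ eq) (∷-injectiveʳ (cong proj₂ eq))))
      (∷-injectiveˡ (cong proj₂ eq)))

    newCode-fresh : ∀ j x → newCode j ≢ code x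
    newCode-fresh j x eq with top-code (y-top j)
    ... | κs , eq′ , len = ℕ.<⇒≱ (s≤s (length-≤ x)) (ℕ.≤-reflexive (begin
      suc q                            ≡⟨ cong suc len ⟨
      suc (suc (length κs))            ≡⟨ cong (suc ∘ length) eq′ ⟨
      length (proj₂ (newCode j))       ≡⟨ cong (length ∘ proj₂) eq ⟩
      length (proj₂ (code x))          ∎))
      where open ≡-Reasoning

    cliques-nonempty : ∀ j → Nonempty (cliquesIn (L j))
    cliques-nonempty j with 1≤∣S∣⇒Nonempty (ℕ.≤-trans (s≤s z≤n) (H.common-V₁ (L-v* j) 1≤q))
    ... | u , u∈ with H.∃-top (L-v* j)
    ... | x , x∈ , tx
      with clique-onto (proj₂ (H.∈N[]⁻ (∈⋂⁻ {F = H.N[ 1 ]} u∈ (H.∈tops⁺ x∈ tx))))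
    ... | i , refl = i , ∈cliquesIn⁺ (H.Adj⇒∈ (L-v* j) λ z∈ tz →
      proj₁ (H.∈N[]⁻ (∈⋂⁻ {F = H.N[ 1 ]} u∈ (H.∈tops⁺ z∈ tz))))

    cliques-⊆ : ∀ {j x} → x ∈ L j → H.Top x → cliquesIn (L j) ⊆ cliquesIn (H.N x)
    cliques-⊆ {j} x∈ tx {i} i∈ = ∈cliquesIn⁺ (H.∈N⁺
      (H.∈⇒Adj (L-v* j) x∈ tx (∈cliquesIn⁻ {L j} i∈) (clique-¬Top i)))

    -- With equality the whole lower neighbourhood of `y j` would lie in `L j`, hence in the
    -- neighbourhood of another top vertex z of `L j`, against `antichain`.
    cliques-⊂ : ∀ j → cliquesIn (L j) ⊂ cliquesIn (H.N (y j))
    cliques-⊂ j = ⊆∧⊈⇒⊂ (cliques-⊆ (y∈ j) (y-top j)) λ ⊇ →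
      let z , z∈ , tz , z≢y = H.other-top (L-v* j) (y j) in
      z≢y (sym (Regular.antichain regular (y-top j) tz λ {u} ¬tu adj →
        H.∈⇒Adj (L-v* j) z∈ tz (lower ⊇ ¬tu adj) ¬tu))
      where
      lower : cliquesIn (H.N (y j)) ⊆ cliquesIn (L j) →
              ∀ {u} → ¬ H.Top u → H.Adj (y j) u → u ∈ L j
      lower ⊇ {u} ¬tu adj with toℕ (H.level u) ℕ.≟ 1
      ... | no  ≢1 = proj₂ (proj₂ (proj₂ (min j))) ≢1 ¬tu adj
      ... | yes ≡1 with clique-onto ≡1
      ... | i , refl = ∈cliquesIn⁻ {L j} (⊇ (∈cliquesIn⁺ (H.∈N⁺ adj)))

    top-closed : ∀ {x} → H.Top x → Closed (cliquesIn (H.N x))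
    top-closed {x} tx =
      let κs , eq , _ = top-code tx in
      All.head (subst (All Closed) eq (Valid.closed (code-valid x)))

    -- The cliques in `L j` are those adjacent to all its top vertices, and an intersection of
    -- closed sets is closed.
    cliques-closed : ∀ j → Closed (cliquesIn (L j))
    cliques-closed j {d} h = ∈cliquesIn⁺ (H.Adj⇒∈ (L-v* j) λ {x} x∈ tx →
      H.∈N⁻ (∈cliquesIn⁻ {H.N x} (top-closed tx λ inAll →
        h λ i∈ → inAll (cliques-⊆ x∈ tx i∈))))

    newCode-valid : ∀ j → Valid (newCode j)
    newCode-valid j =
      let κs , eq , _ = top-code (y-top j)
          v           = proj₁ (code (y j))
      in subst (λ κs → Valid (v , cliquesIn (L j) ∷ κs)) (sym eq)
        (Valid-∷ (cliques-nonempty j) (cliques-closed j) (cliques-⊂ j)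
          (subst (λ κs → Valid (v , κs)) eq (code-valid (y j))))

    open Extension factor coding newCode newCode-injective newCode-fresh newCode-valid
      using (extended)
      renaming (topCoded to extended-topCoded) public

    extended-top : TopCoded extended
    extended-top = extended-topCoded (λ x → ℕ.≤-trans (length-≤ x) (ℕ.n≤1+n q))
      λ j → let κs , eq , len = top-code (y-top j) in
        proj₂ (code (y j)) , refl , trans (cong length eq) len

  factor-coded-step : ∀ {q} {H : Multipartite (2 + q)} {G : Multipartite (3 + q)} →
                      IsCleanFactor H G → 1 ≤ q → Regular H →
                      (coding : Coding H) → TopCoded coding →
                      ∃ λ (coding : Coding G) → Regular G × TopCoded coding
  factor-coded-step factor 1≤q regular coding top =
    CodingStep.extended factor 1≤q regular coding top ,
    Step.regular-step factor 1≤q regular ,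
    CodingStep.extended-top factor 1≤q regular coding top

-- Codes of the vertices of levels 0, 1 and 2

module CodingBase {n k : ℕ} .{{_ : NonZero n}} (C : Fin k → Subset n)
                  (C-nonempty : ∀ j → Nonempty (C j)) (C-⊆⇒≡ : ∀ {i j} → C i ⊆ C j → i ≡ j)
                  {H : Multipartite 2} (incidence : AddsLevel (edgeless n) C H) where
  open Codes C
  private
    module I = AddsLevel incidence
    module H where
      open Multipartite H public
      open Star H public
      open Membership H public
      open Closure H public

  Case : Fin H.order → Set
  Case x = (∃ λ v → I.old v ≡ x) ⊎ (∃ λ j → I.new j ≡ x)

  codeOf : ∀ {x} → Case x → Code
  codeOf (inj₁ (v , _)) = v , []
  codeOf (inj₂ (j , _)) = proj₁ (C-nonempty j) , ⁅ j ⁆ ∷ []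

  ⁅⁆-injective : {i j : Fin k} → ⁅ i ⁆ ≡ ⁅ j ⁆ → i ≡ j
  ⁅⁆-injective {i} {j} eq = x∈⁅y⁆⇒x≡y j (subst (i ∈_) eq (x∈⁅x⁆ i))

  codeOf-injective : ∀ {x y} (a : Case x) (b : Case y) → codeOf a ≡ codeOf b → x ≡ y
  codeOf-injective (inj₁ (_ , refl)) (inj₁ (_ , refl)) eq = cong I.old (cong proj₁ eq)
  codeOf-injective (inj₁ _)          (inj₂ _)          eq with () ← cong proj₂ eq
  codeOf-injective (inj₂ _)          (inj₁ _)          eq with () ← cong proj₂ eq
  codeOf-injective (inj₂ (_ , refl)) (inj₂ (_ , refl)) eq =
    cong I.new (⁅⁆-injective (∷-injectiveˡ (cong proj₂ eq)))

  -- A maximal clique that includes `C j` is `C j` itself.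
  singleton-closed : ∀ j → Closed ⁅ j ⁆
  singleton-closed j {d} h = subst (_∈ ⁅ j ⁆) (C-⊆⇒≡ Cj⊆Cd) (x∈⁅x⁆ j)
    where
    Cj⊆Cd : C j ⊆ C d
    Cj⊆Cd {v} v∈ = h λ i∈ → subst (λ i → v ∈ C i) (sym (x∈⁅y⁆⇒x≡y j i∈)) v∈

  Valid-[_] : ∀ {v κ} → Closed κ → Nonempty κ → κ ⊆ through v → Valid (v , κ ∷ [])
  Valid-[_] closed (i , i∈) κ⊆ = record
    { ascending = (⊥⊆ , i , i∈ , ∉⊥) ∷ [-] ; closed = closed ∷ [] ; within = κ⊆ ∷ [] }

  codeOf-valid : ∀ {x} (a : Case x) → Valid (codeOf a)
  codeOf-valid (inj₁ _)       = record { ascending = [-] ; closed = [] ; within = [] }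
  codeOf-valid (inj₂ (j , _)) = Valid-[ singleton-closed j ] (j , x∈⁅x⁆ j) λ i∈ →
    let v , v∈ = C-nonempty j in
    ∈through⁺ (subst (λ i → v ∈ C i) (sym (x∈⁅y⁆⇒x≡y j i∈)) v∈)

  coding : Coding H
  coding = record
    { clique         = I.new
    ; clique-level   = I.level-new
    ; clique-onto    = I.top-new
    ; code           = codeOf ∘ I.old⊎new
    ; code-injective = λ {x} {y} → codeOf-injective (I.old⊎new x) (I.old⊎new y)
    ; code-valid     = codeOf-valid ∘ I.old⊎new
    }

  open Coding coding

  module _ {G : Multipartite 3} (factor : IsCleanFactor H G) where
    open Step factor

    old-Adj⁺ : ∀ {j v} → v ∈ C j → H.Adj (I.new j) (I.old v)
    old-Adj⁺ = subst id (sym (I.Adj-new _ _))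

    old-Adj⁻ : ∀ {j v} → H.Adj (I.new j) (I.old v) → v ∈ C j
    old-Adj⁻ = subst id (I.Adj-new _ _)

    cliques-⊆ : ∀ {i j} → cliquesIn (L i) ≡ cliquesIn (L j) → ∀ {x} → H.Top x → x ∈ L i → x ∈ L j
    cliques-⊆ {i} {j} κ≡ tx x∈ with I.top-new tx
    ... | d , refl = ∈cliquesIn⁻ {L j} (subst (d ∈_) κ≡ (∈cliquesIn⁺ x∈))

    L-⊆ : ∀ {i j} → cliquesIn (L i) ≡ cliquesIn (L j) → L i ⊆ L j
    L-⊆ {i} {j} κ≡ {u} u∈ with H.top? u
    ... | yes tu = cliques-⊆ {i} {j} κ≡ tu u∈
    ... | no ¬tu = H.Adj⇒∈ (L-v* j) λ x∈ tx →
      H.∈⇒Adj (L-v* i) (cliques-⊆ {j} {i} (sym κ≡) tx x∈) tx u∈ ¬tu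

    cliques-nonempty : ∀ j → Nonempty (cliquesIn (L j))
    cliques-nonempty j with H.∃-top (L-v* j)
    ... | x , x∈ , tx with I.top-new tx
    ... | i , refl = i , ∈cliquesIn⁺ x∈

    L-vertex : ∀ j → ∃ λ v → I.old v ∈ L j
    L-vertex j with 1≤∣S∣⇒Nonempty
      (ℕ.≤-trans (s≤s z≤n) (Star.Good.common (proj₁ (V*⇒Good H (L-v* j)))))
    ... | u , u∈ with H.∃-top (L-v* j)
    ... | x , x∈ , tx with I.lower-old {u} (λ tu →
      H.Top⇒¬Adj tx tu (H.∈N⁻ (∈⋂⁻ {F = H.N} u∈ (H.∈tops⁺ x∈ tx))))
    ... | v , refl = v , H.Adj⇒∈ (L-v* j) λ z∈ tz → H.∈N⁻ (∈⋂⁻ {F = H.N} u∈ (H.∈tops⁺ z∈ tz))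

    newCode : Fin size → Code
    newCode j = proj₁ (L-vertex j) , cliquesIn (L j) ∷ []

    old∈⇒∈C : ∀ {j v} → I.old v ∈ L j → ∀ {i} → i ∈ cliquesIn (L j) → v ∈ C i
    old∈⇒∈C {j} {v} v∈ {i} i∈ = old-Adj⁻
      (H.∈⇒Adj (L-v* j) (∈cliquesIn⁻ {L j} i∈) (I.level-new i) v∈ (I.¬Top-old v))

    -- A clique that includes the intersection of those in `L j` is joined to the lower part of
    -- `L j`, so maximality absorbs it.
    cliques-closed : ∀ j → Closed (cliquesIn (L j))
    cliques-closed j {d} h = ∈cliquesIn⁺ (H.absorb (L-maximal j) (I.level-new d) joined λ ())
      where
      joined : ∀ {u} → u ∈ L j → ¬ H.Top u → H.Adj (I.new d) u
      joined u∈ ¬tu with I.lower-old ¬tu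
      ... | v , refl = old-Adj⁺ (h (old∈⇒∈C u∈))

    -- Codes of level 1 have length one as well, but consist of a singleton, whereas `L j` contains
    -- at least two cliques.
    newCode-fresh : ∀ j x → newCode j ≢ code x
    newCode-fresh j x = fresh (I.old⊎new x)
      where
      fresh : (a : Case x) → newCode j ≢ codeOf a
      fresh (inj₁ _)       eq with () ← cong proj₂ eq
      fresh (inj₂ (d , _)) eq with H.other-top (L-v* j) (I.new d)
      ... | y , y∈ , ty , y≢ with I.top-new ty
      ... | i , refl = y≢ (cong I.new (x∈⁅y⁆⇒x≡y d
        (subst (i ∈_) (∷-injectiveˡ (cong proj₂ eq)) (∈cliquesIn⁺ y∈))))

    open Extension factor coding newCode
      (λ {i} {j} eq → L-⊆⇒≡ (L-⊆ {i} {j} (∷-injectiveˡ (cong proj₂ eq))))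
      newCode-fresh
      (λ j → Valid-[ cliques-closed j ] (cliques-nonempty j)
        (λ i∈ → ∈through⁺ (old∈⇒∈C (proj₂ (L-vertex j)) i∈)))
      using (extended)
      renaming (topCoded to extended-topCoded) public

    extended-top : TopCoded extended
    extended-top = extended-topCoded (λ x → length-codeOf (I.old⊎new x)) λ j → [] , refl , refl
      where
      length-codeOf : ∀ {x} (a : Case x) → length (proj₂ (codeOf a)) ≤ 1
      length-codeOf (inj₁ _) = z≤n
      length-codeOf (inj₂ _) = ℕ.≤-refl

  factor-coded : ∀ {G : Multipartite 3} → IsCleanFactor H G →
                 ∃ λ (coding : Coding G) → Regular G × TopCoded coding
  factor-coded factor = extended factor , Step.regular-base factor refl , extended-top factor

-- The bounds

!-mono-≤ : m ≤ n → m ! ≤ n !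
!-mono-≤ {n = zero}  z≤n     = ℕ.≤-refl
!-mono-≤ {n = suc n} z≤n     = ℕ.*-mono-≤ (s≤s (z≤n {n})) (!-mono-≤ {n = n} z≤n)
!-mono-≤             (s≤s m≤n) = ℕ.*-mono-≤ (s≤s m≤n) (!-mono-≤ m≤n)

length-chains-≤ : ∀ {k} (S : Subset n) → ∣ S ∣ ≤ k → length (chains S) ≤ 2 ^ k * k !
length-chains-≤ S ∣S∣≤k = ℕ.≤-trans (length-chains S)
  (ℕ.*-mono-≤ (ℕ.^-monoʳ-≤ 2 ∣S∣≤k) (!-mono-≤ ∣S∣≤k))

-- Chains of subsets of a single clique

module Separation {n k : ℕ} (C : Fin k → Subset n) where
  open Codes C

  -- For v ∈ D with D one of the sets C j, j ∈ κ, this is the complement in D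
  -- of the intersection of the sets C j, with v added to make it non-empty.
  Missing : Fin n → Subset n → Subset k → Fin n → Set
  Missing v D κ u = u ∈ D × (u ≡ v ⊎ ∃ λ j → j ∈ κ × u ∉ C j)

  missing? : ∀ v D κ u → Dec (Missing v D κ u)
  missing? v D κ u =
    (u ∈? D) ×-dec ((u Fin.≟ v) ⊎-dec Fin.any? λ j → (j ∈? κ) ×-dec ¬? (u ∈? C j))

  missing : Fin n → Subset n → Subset k → Subset n
  missing v D κ = ⟪ missing? v D κ ⟫

  missing-mono : ∀ {v D κ κ′} → κ ⊆ κ′ → missing v D κ ⊆ missing v D κ′
  missing-mono {v} {D} {κ} {κ′} κ⊆κ′ u∈ with ∈⟪⟫⁻ (missing? v D κ) u∈
  ... | u∈D , inj₁ u≡v            = ∈⟪⟫⁺ (missing? v D κ′) (u∈D , inj₁ u≡v)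
  ... | u∈D , inj₂ (j , j∈ , u∉)  = ∈⟪⟫⁺ (missing? v D κ′) (u∈D , inj₂ (j , κ⊆κ′ j∈ , u∉))

  missing-⊆ : ∀ {v D κ} → missing v D κ ⊆ D
  missing-⊆ {v} {D} {κ} u∈ = proj₁ (∈⟪⟫⁻ (missing? v D κ) u∈)

  -- For d in κ, a vertex of the intersection over κ′ that avoids `C d` would be missing for κ,
  -- hence for κ′. It is not v, as v lies in `C d`, and it avoids no set of κ′. So `C d` includes
  -- the intersection, and closedness puts d into κ′.
  missing-reflects-⊆ : ∀ {v j κ κ′} → κ ⊆ through v → Closed κ′ → j ∈ κ′ →
                       missing v (C j) κ ⊆ missing v (C j) κ′ → κ ⊆ κ′
  missing-reflects-⊆ {v} {j} {κ} {κ′} κ⊆ closed j∈κ′ sub {d} d∈ = closed λ {u} inAll →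
    decidable-stable (u ∈? C d) λ u∉Cd →
      absurd inAll u∉Cd (∈⟪⟫⁻ (missing? v (C j) κ′)
        (sub (∈⟪⟫⁺ (missing? v (C j) κ) (inAll j∈κ′ , inj₂ (d , d∈ , u∉Cd)))))
    where
    absurd : ∀ {u} → InAll κ′ u → u ∉ C d → ¬ Missing v (C j) κ′ u
    absurd inAll u∉Cd (_ , inj₁ refl)         = u∉Cd (∈through⁻ (κ⊆ d∈))
    absurd inAll u∉Cd (_ , inj₂ (i , i∈ , u∉)) = u∉ (inAll i∈)

  map-missing-injective : ∀ {v j κs κs′} →
    All Closed κs → All Closed κs′ → All (_⊆ through v) κs → All (_⊆ through v) κs′ →
    All (j ∈_) κs → All (j ∈_) κs′ →
    map (missing v (C j)) κs ≡ map (missing v (C j)) κs′ → κs ≡ κs′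
  map-missing-injective [] [] [] [] [] [] eq = refl
  map-missing-injective (c ∷ cs) (c′ ∷ cs′) (w ∷ ws) (w′ ∷ ws′) (j∈ ∷ js) (j∈′ ∷ js′) eq =
    cong₂ _∷_
      (⊆-antisym
        (missing-reflects-⊆ w c′ j∈′ (subst (_ ∈_) (∷-injectiveˡ eq)))
        (missing-reflects-⊆ w′ c j∈ (subst (_ ∈_) (sym (∷-injectiveˡ eq)))))
      (map-missing-injective cs cs′ ws ws′ js js′ (∷-injectiveʳ eq))
  map-missing-injective [] (_ ∷ _) [] (_ ∷ _) [] (_ ∷ _) ()
  map-missing-injective (_ ∷ _) [] (_ ∷ _) [] (_ ∷ _) [] ()

  map-missing-ascending : ∀ {v j κ κs} →
    Linked _⊂_ (κ ∷ κs) → All Closed (κ ∷ κs) → All (_⊆ through v) (κ ∷ κs) → All (j ∈_) (κ ∷ κs) →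
    Linked _⊂_ (map (missing v (C j)) (κ ∷ κs))
  map-missing-ascending [-] _ _ _ = [-]
  map-missing-ascending (κ⊂κ′ ∷ link) (c ∷ cs) (_ ∷ ws@(w′ ∷ _)) (j∈ ∷ js) =
    ⊆∧⊈⇒⊂ (missing-mono (proj₁ κ⊂κ′))
      (λ ⊇ → ⊂-irref refl (⊂-⊆-trans κ⊂κ′ (missing-reflects-⊆ w′ c j∈ ⊇)))
    ∷ map-missing-ascending link cs ws js

  all-∈ : ∀ {i} {κ : Subset k} {κs} → i ∈ κ → Linked _⊂_ (κ ∷ κs) → All (i ∈_) (κ ∷ κs)
  all-∈ i∈ [-]           = i∈ ∷ []
  all-∈ i∈ (κ⊂κ′ ∷ link) = i∈ ∷ all-∈ (proj₁ κ⊂κ′ i∈) link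

  module _ (covered : ∀ v → ∃ λ j → v ∈ C j) where

    -- An element of the first set belongs to the whole chain; for the empty chain any maximal
    -- clique through v will do.
    choose : ∀ {v} κs → Valid (v , κs) → ∃ λ j → v ∈ C j × All (j ∈_) κs
    choose {v} []       _     = let j , v∈ = covered v in j , v∈ , []
    choose     (κ ∷ κs) valid with Valid.ascending valid | Valid.within valid
    ... | (_ , i , i∈ , _) ∷ link | κ⊆ ∷ _ = i , ∈through⁻ (κ⊆ i∈) , all-∈ i∈ link

    transposed : ∀ {v κs} → Valid (v , κs) → Fin n × Subset n × List (Subset n)
    transposed {v} {κs} valid =
      let D = C (proj₁ (choose κs valid)) in v , D , map (missing v D) κs

    transposed-injective : ∀ {v v′ κs κs′} (valid : Valid (v , κs)) (valid′ : Valid (v′ , κs′)) →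
      (∀ {i j} → C i ≡ C j → i ≡ j) →
      transposed valid ≡ transposed valid′ → (v , κs) ≡ (v′ , κs′)
    transposed-injective {κs = κs} {κs′} valid valid′ C-injective eq
      with choose κs valid | choose κs′ valid′
    ... | j , _ , js | j′ , _ , js′ with cong proj₁ eq | C-injective (cong (proj₁ ∘ proj₂) eq)
    ... | refl | refl = cong (_ ,_) (map-missing-injective
      (Valid.closed valid) (Valid.closed valid′) (Valid.within valid) (Valid.within valid′)
      js js′ (cong (proj₂ ∘ proj₂) eq))

    transposed∈chains : ∀ {v κs} (valid : Valid (v , κs)) →
      let _ , D , As = transposed valid in As ∈ˡ chains D
    transposed∈chains {v} {κs} valid with choose κs valid
    ... | j , v∈ , js = ∈-chains (C j)
      (ascending κs (Valid.ascending valid) (Valid.closed valid) (Valid.within valid) js)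
      (below κs)
      where
      below : ∀ κs → All (_⊆ C j) (map (missing v (C j)) κs)
      below []       = []
      below (κ ∷ κs) = missing-⊆ {v} {C j} {κ} ∷ below κs

      ascending : ∀ κs → Linked _⊂_ (Subset.⊥ ∷ κs) → All Closed κs → All (_⊆ through v) κs →
                  All (j ∈_) κs → Linked _⊂_ (Subset.⊥ ∷ map (missing v (C j)) κs)
      ascending []       _          _  _  _  = [-]
      ascending (κ ∷ κs) (_ ∷ link) cs ws js =
        -- The added vertex v is what makes the first set strictly larger than `Subset.⊥`.
        (⊥⊆ , v , ∈⟪⟫⁺ (missing? v (C j) κ) (v∈ , inj₁ refl) , ∉⊥)
        ∷ map-missing-ascending link cs ws js

-- Counting the codes

module Counting {n : ℕ} (Cs : List (Subset n)) where
  open Codes (List.lookup Cs)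
  open Separation (List.lookup Cs)

  -- A code is one of n vertices v with a strict chain of subsets of `through v`, which has at most
  -- k elements.
  order-≤₁ : ∀ {q} {H : Multipartite (2 + q)} → Coding H → ∀ k →
             (∀ v → length (filter (v ∈?_) Cs) ≤ k) →
             Multipartite.order H ≤ 2 ^ k * k ! * n
  order-≤₁ {H = H} coding k bound = begin
    Multipartite.order H
      ≤⟨ injective⇒≤length code code-injective codes code∈ ⟩
    length codes
      ≤⟨ length-concatMap-≤ f (2 ^ k * k !) (allFin n) length-f ⟩
    length (allFin n) * (2 ^ k * k !)
      ≡⟨ cong (_* (2 ^ k * k !)) (length-tabulate {n = n} id) ⟩
    n * (2 ^ k * k !)
      ≡⟨ ℕ.*-comm n _ ⟩
    2 ^ k * k ! * n ∎
    where
    open ℕ.≤-Reasoning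
    open Coding coding

    f : Fin n → List Code
    f v = map (v ,_) (chains (through v))

    codes = concatMap f (allFin n)

    length-f : ∀ {v} → v ∈ˡ allFin n → length (f v) ≤ 2 ^ k * k !
    length-f {v} _ = subst (_≤ 2 ^ k * k !) (sym (length-map (v ,_) (chains (through v))))
      (length-chains-≤ (through v) (subst (_≤ k) (sym (∣⟪lookup⟫∣ (v ∈?_) Cs)) (bound v)))

    code∈ : ∀ x → code x ∈ˡ codes
    code∈ x = ∈-concatMap⁺ f (lose (∈-allFin (proj₁ (code x)))
      (∈-map⁺ _ (∈-chains (through (proj₁ (code x)))
        (Valid.ascending (code-valid x)) (Valid.within (code-valid x)))))

  -- Here a code becomes a vertex v, one of at most k maximal cliques D through v, and a strict
  -- chain of subsets of D, which has at most c elements.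
  order-≤₂ : ∀ {q} {H : Multipartite (2 + q)} → Coding H → ∀ k c →
             (∀ v → length (filter (v ∈?_) Cs) ≤ k) → (∀ {D} → D ∈ˡ Cs → ∣ D ∣ ≤ c) →
             (∀ {i j} → List.lookup Cs i ≡ List.lookup Cs j → i ≡ j) →
             (∀ v → ∃ λ j → v ∈ List.lookup Cs j) →
             Multipartite.order H ≤ k * 2 ^ c * c ! * n
  order-≤₂ {H = H} coding k c bound size injective covered = begin
    Multipartite.order H
      ≤⟨ injective⇒≤length code′ code′-injective codes code′∈ ⟩
    length codes
      ≤⟨ length-concatMap-≤ f (k * (2 ^ c * c !)) (allFin n) (λ {v} _ → length-f v) ⟩
    length (allFin n) * (k * (2 ^ c * c !))
      ≡⟨ cong (_* (k * (2 ^ c * c !))) (length-tabulate {n = n} id) ⟩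
    n * (k * (2 ^ c * c !))
      ≡⟨ ℕ.*-comm n _ ⟩
    k * (2 ^ c * c !) * n
      ≡⟨ cong (_* n) (ℕ.*-assoc k (2 ^ c) (c !)) ⟨
    k * 2 ^ c * c ! * n ∎
    where
    open ℕ.≤-Reasoning
    open Coding coding

    g : Fin n → Subset n → List (Fin n × Subset n × List (Subset n))
    g v D = map (λ As → v , D , As) (chains D)

    f : Fin n → List (Fin n × Subset n × List (Subset n))
    f v = concatMap (g v) (filter (v ∈?_) Cs)

    codes = concatMap f (allFin n)

    length-g : ∀ v {D} → D ∈ˡ filter (v ∈?_) Cs → length (g v D) ≤ 2 ^ c * c !
    length-g v {D} D∈ = subst (_≤ 2 ^ c * c !) (sym (length-map _ (chains D)))
      (length-chains-≤ D (size (proj₁ (∈-filter⁻ (v ∈?_) {xs = Cs} D∈))))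

    length-f : ∀ v → length (f v) ≤ k * (2 ^ c * c !)
    length-f v = ℕ.≤-trans (length-concatMap-≤ (g v) (2 ^ c * c !) _ (length-g v))
      (ℕ.*-monoˡ-≤ (2 ^ c * c !) (bound v))

    code′ : Fin (Multipartite.order H) → Fin n × Subset n × List (Subset n)
    code′ x = transposed covered (code-valid x)

    code′-injective : ∀ {x y} → code′ x ≡ code′ y → x ≡ y
    code′-injective {x} {y} eq = code-injective
      (transposed-injective covered (code-valid x) (code-valid y) injective eq)

    code′∈ : ∀ x → code′ x ∈ˡ codes
    code′∈ x = ∈-concatMap⁺ f (lose (∈-allFin v)
      (∈-concatMap⁺ (g v) (lose
        (∈-filter⁺ (v ∈?_) (∈-lookup {xs = Cs} (proj₁ chosen)) (proj₁ (proj₂ chosen)))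
        (∈-map⁺ _ (transposed∈chains covered (code-valid x))))))
      where
      v = proj₁ (code x)
      chosen = choose covered (proj₂ (code x)) (code-valid x)

-- Induction along the clean-factor series

module Series {n : ℕ} .{{_ : NonZero n}} (G : Graph n) where

  C : Fin (length (maximalCliques G)) → Subset n
  C = List.lookup (maximalCliques G)

  open Codes C

  C-maximal : ∀ j → MaximalClique G (C j)
  C-maximal = lookup-maximal (clique? G)

  C-injective : ∀ {i j} → C i ≡ C j → i ≡ j
  C-injective = lookup-injective (maximals-unique (clique? G))

  C-⊆⇒≡ : ∀ {i j} → C i ⊆ C j → i ≡ j
  C-⊆⇒≡ {i} {j} Ci⊆Cj = C-injective
    (⊆-antisym Ci⊆Cj (maximal-⊆ (clique? G) (C-maximal i) (proj₁ (C-maximal j)) Ci⊆Cj))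

  singleton-clique : ∀ v → Clique G ⁅ v ⁆
  singleton-clique v x∈ y∈ x≢y =
    contradiction (trans (x∈⁅y⁆⇒x≡y v x∈) (sym (x∈⁅y⁆⇒x≡y v y∈))) x≢y

  covered : ∀ v → ∃ λ j → v ∈ C j
  covered v with ∃-maximal-above (clique? G) (λ {x} → singleton-clique v {x})
  ... | D , max , v⊆D with maximal-index (clique? G) max
  ... | j , refl = j , v⊆D (x∈⁅x⁆ v)

  -- An empty maximal clique would include every singleton clique, and n ≠ 0 provides a vertex.
  C-nonempty : ∀ j → Nonempty (C j)
  C-nonempty j with nonempty? (C j)
  ... | yes ne    = ne
  ... | no  empty = v , maximal-⊆ (clique? G) (C-maximal j) (λ {x} → singleton-clique v {x})
    (λ u∈ → contradiction (_ , u∈) empty) (x∈⁅x⁆ v)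
    where
    v : Fin n
    v = fromℕ< (>-nonZero⁻¹ n)

  -- The incidence graph gets its own constructor, because for two levels `TopCoded` would ask for
  -- non-empty chains of length 0.
  data Coded : ∀ {q} → Multipartite (2 + q) → Set₁ where
    incidence : {H : Multipartite 2} → AddsLevel (edgeless n) C H → Coded H
    factored  : ∀ {q} {H : Multipartite (3 + q)} → Regular H →
                (coding : Coding H) → TopCoded coding → Coded H

  Coded-next : ∀ {q} {H : Multipartite (2 + q)} {H′} → IsCleanFactor H H′ → Coded H → Coded H′
  Coded-next factor (incidence inc) =
    let coding , regular , top = CodingBase.factor-coded C C-nonempty C-⊆⇒≡ inc factor
    in factored regular coding top
  Coded-next factor (factored regular coding top) =
    let coding′ , regular′ , top′ = factor-coded-step factor (s≤s z≤n) regular coding top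
    in factored regular′ coding′ top′

  coded : ∀ {q} {H : Multipartite (2 + q)} → CleanFactorSeries G H → Coded H
  coded first              = incidence (addLevel-addsLevel (edgeless n) (maximalCliques G) _)
  coded (next {H = H} s e) = Coded-next (cleanFactor-isCleanFactor H e) (coded s)

  Coded⇒Coding : ∀ {q} {H : Multipartite (2 + q)} → Coded H → Coding H
  Coded⇒Coding (incidence inc)       = CodingBase.coding C C-nonempty C-⊆⇒≡ inc
  Coded⇒Coding (factored _ coding _) = coding

theorem3 : (n : ℕ) .{{_ : NonZero n}} (G : Graph n)
    {q : ℕ} (M : Multipartite (2 + q)) → TerminatesAt G M →
    (k c : ℕ) →
    ((v : Fin n) → length (filter (v ∈?_) (maximalCliques G)) ≤ k) →
    ((C : Subset n) → MaximalClique G C → ∣ C ∣ ≤ c) →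
    Multipartite.order M ≤ ((k * 2 ^ c * (c !)) ⊓ (2 ^ k * (k !) + 1)) * n
theorem3 n G M (series , _) k c ≤k ≤c = begin
  Multipartite.order M
    ≤⟨ ℕ.⊓-glb (order-≤₂ coding k c ≤k clique-≤ C-injective covered)
               (ℕ.≤-trans (order-≤₁ coding k ≤k) (ℕ.*-monoˡ-≤ n (ℕ.m≤m+n (2 ^ k * k !) 1))) ⟩
  (k * 2 ^ c * c ! * n) ⊓ ((2 ^ k * k ! + 1) * n)
    ≡⟨ ℕ.*-distribʳ-⊓ n (k * 2 ^ c * c !) (2 ^ k * k ! + 1) ⟨
  ((k * 2 ^ c * c !) ⊓ (2 ^ k * k ! + 1)) * n ∎
  where
  open ℕ.≤-Reasoning
  open Series G
  open Counting (maximalCliques G)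

  coding = Coded⇒Coding (coded series)

  clique-≤ : ∀ {D} → D ∈ˡ maximalCliques G → ∣ D ∣ ≤ c
  clique-≤ {D} D∈ = ≤c D (proj₂ (∈-filter⁻ (maximal? (clique? G)) {xs = subsets n} D∈))
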